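{- Let $p$ be a prime and let $G$ be a non-abelian finite $p$-group. (1) Suppose $|G|=p^{m+n}$ for integers $1\le n<m$, that $G$ is not isomorphic to the quaternion group of order $8$, and that $G$ contains an element of order $p^m$. Then $G$ satisfies $\mathcal P(p)$. (2) Suppose $G$ contains an element of order at least $\max(p^2,8)$, and let $\alpha$ be an element of order $p$ in the center $\mathcal Z(G)$. Then either $G$ satisfies $\mathcal P(p)$, or $G/\langle\alpha\rangle$ satisfies $\mathcal P(p)$. Consequently, $G\times(G/\langle\alpha\rangle)$ satisfies $\mathcal P(p)$.
   Context: For a finite group $\Gamma$, $\ell\ge1$ and $x\in\Gamma$, $r_\ell(x)=|\{g\in\Gamma:g^\ell=x\}|$. $\Gamma$ satisfies $\mathcal P(p)$ if there exist $a,b\in\Gamma$ of the same order with $0=r_p(a)<r_p(b)$ and $r_\ell(a)=r_\ell(b)$ for every square-free integer $1<\ell<p$. -}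

module Defs where

open import Data.Nat using (ℕ; zero; suc; _*_; _≤_; _<_; _^_)
open import Data.Nat.Divisibility using (_∣_)
open import Data.Bool using (Bool; true; false; _xor_)
open import Data.List using (List; length; filter; cartesianProduct)
open import Data.List.Membership.Propositional using (_∈_)
open import Data.List.Membership.Propositional.Properties using (∈-cartesianProduct⁺)
open import Data.List.Relation.Unary.Unique.Propositional using (Unique)
open import Data.List.Relation.Unary.Unique.Propositional.Properties using (cartesianProduct⁺)
open import Data.Product using (Σ; ∃; ∃-syntax; _×_; _,_; proj₁; proj₂)
open import Data.Product.Properties using (≡-dec)
open import Data.Sum using (_⊎_)
open import Relation.Nullary using (¬_)
open import Relation.Binary.Definitions using (DecidableEquality)
open import Relation.Binary.PropositionalEquality
  using (_≡_; _≢_; refl; cong₂; isEquivalence)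
open import Algebra.Structures using (IsGroup)
open import Function.Definitions using (Injective; Surjective)

record FinGroup : Set₁ where
  infixl 7 _∙_
  field
    Carrier  : Set
    _≟_      : DecidableEquality Carrier
    elems    : List Carrier
    complete : ∀ x → x ∈ elems
    unique   : Unique elems
    _∙_      : Carrier → Carrier → Carrier
    ε        : Carrier
    _⁻¹      : Carrier → Carrier
    isGroup  : IsGroup _≡_ _∙_ ε _⁻¹

  card : ℕ
  card = length elems

  pow : Carrier → ℕ → Carrier
  pow g zero    = ε
  pow g (suc k) = g ∙ pow g k

  r : ℕ → Carrier → ℕ
  r ℓ x = length (filter (λ g → pow g ℓ ≟ x) elems)

  HasOrder : Carrier → ℕ → Set
  HasOrder g k = 1 ≤ k × pow g k ≡ ε × (∀ j → 1 ≤ j → j < k → pow g j ≢ ε)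

  SameOrder : Carrier → Carrier → Set
  SameOrder a b = ∃[ k ] (HasOrder a k × HasOrder b k)

  Central : Carrier → Set
  Central a = ∀ y → a ∙ y ≡ y ∙ a

  -- membership in the cyclic subgroup ⟨a⟩ (G finite, so nonnegative powers suffice)
  InCyclic : Carrier → Carrier → Set
  InCyclic a g = ∃[ k ] (g ≡ pow a k)

open FinGroup public

SquareFree : ℕ → Set
SquareFree ℓ = ∀ d → d * d ∣ ℓ → d ≡ 1

IsPGroup : ℕ → FinGroup → Set
IsPGroup p G = ∃[ k ] (card G ≡ p ^ k)

Abelian : FinGroup → Set
Abelian G = ∀ x y → _∙_ G x y ≡ _∙_ G y x

NonAbelian : FinGroup → Set
NonAbelian G = ¬ Abelian G

SatP : ℕ → FinGroup → Set
SatP p Γ = ∃[ a ] ∃[ b ]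
  ( SameOrder Γ a b
  × r Γ p a ≡ 0
  × 0 < r Γ p b
  × (∀ ℓ → 1 < ℓ → ℓ < p → SquareFree ℓ → r Γ ℓ a ≡ r Γ ℓ b))

IsHom : (G H : FinGroup) → (Carrier G → Carrier H) → Set
IsHom G H f = ∀ x y → f (_∙_ G x y) ≡ _∙_ H (f x) (f y)

IsQuotientByCyclic : (G : FinGroup) → Carrier G → FinGroup → Set
IsQuotientByCyclic G α H =
  Σ (Carrier G → Carrier H) λ f →
    IsHom G H f × Surjective _≡_ _≡_ f
    × (∀ g → (f g ≡ ε H → InCyclic G α g) × (InCyclic G α g → f g ≡ ε H))

data QU : Set where
  𝟙 𝕚 𝕛 𝕜 : QU

-- product of units: (sign flip?, unit)
qmulU : QU → QU → Bool × QU
qmulU 𝟙 v = false , v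
qmulU u 𝟙 = false , u
qmulU 𝕚 𝕚 = true , 𝟙
qmulU 𝕛 𝕛 = true , 𝟙
qmulU 𝕜 𝕜 = true , 𝟙
qmulU 𝕚 𝕛 = false , 𝕜
qmulU 𝕛 𝕚 = true , 𝕜
qmulU 𝕛 𝕜 = false , 𝕚
qmulU 𝕜 𝕛 = true , 𝕚
qmulU 𝕜 𝕚 = false , 𝕛
qmulU 𝕚 𝕜 = true , 𝕛

-- elements (s , u) stand for (-1)^s · u
Q8 : Set
Q8 = Bool × QU

q8mul : Q8 → Q8 → Q8
q8mul (s , u) (t , v) = ((s xor t) xor proj₁ (qmulU u v)) , proj₂ (qmulU u v)

IsoQ8 : FinGroup → Set
IsoQ8 G = Σ (Q8 → Carrier G) λ f →
  Injective _≡_ _≡_ f × Surjective _≡_ _≡_ f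
  × (∀ x y → f (q8mul x y) ≡ _∙_ G (f x) (f y))

module _ (G H : FinGroup) where
  private
    module G = IsGroup (isGroup G)
    module H = IsGroup (isGroup H)

  _×ᴳ_ : FinGroup
  _×ᴳ_ = record
    { Carrier  = Carrier G × Carrier H
    ; _≟_      = ≡-dec (_≟_ G) (_≟_ H)
    ; elems    = cartesianProduct (elems G) (elems H)
    ; complete = λ { (x , y) → ∈-cartesianProduct⁺ (complete G x) (complete H y) }
    ; unique   = cartesianProduct⁺ (unique G) (unique H)
    ; _∙_      = λ { (a , b) (c , d) → _∙_ G a c , _∙_ H b d }
    ; ε        = ε G , ε H
    ; _⁻¹      = λ { (a , b) → _⁻¹ G a , _⁻¹ H b }
    ; isGroup  = record
      { isMonoid = record
        { isSemigroup = record
          { isMagma = record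
            { isEquivalence = isEquivalence
            ; ∙-cong = λ { refl refl → refl } }
          ; assoc = λ { (a , b) (c , d) (e , f) → cong₂ _,_ (G.assoc a c e) (H.assoc b d f) } }
        ; identity = (λ { (a , b) → cong₂ _,_ (proj₁ G.identity a) (proj₁ H.identity b) })
                   , (λ { (a , b) → cong₂ _,_ (proj₂ G.identity a) (proj₂ H.identity b) }) }
      ; inverse = (λ { (a , b) → cong₂ _,_ (proj₁ G.inverse a) (proj₁ H.inverse b) })
                , (λ { (a , b) → cong₂ _,_ (proj₂ G.inverse a) (proj₂ H.inverse b) })
      ; ⁻¹-cong = λ { refl → refl } } }

module Submission where

-- In a group of exponent dividing p ^ K every ℓ prime to p has unique ℓ-th roots, so 𝒫(p) asks only
-- for two elements of the same order of which exactly one is a p-th power. Let p ^ (e + 1) be the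
-- exponent of G. If 𝒫(p) fails, every element killed by p ^ e is a p-th power; in particular every
-- element of order p is a (p ^ e)-th power. In (1) a pigeonhole on products xⁱ yʲ, and in (2) the
-- failure of 𝒫(p) for the quotient, then leaves only one subgroup of order p. By induction on s the
-- solutions of x ^ (p ^ s) = 1 form a cyclic group ⟨a⟩, which is central since every element lies in a
-- cyclic group of order p ^ (e + 1): the class equation of G / ⟨a⟩ yields u ∉ ⟨a⟩ central modulo ⟨a⟩,
-- and for v killed by p ^ (s + 1) a class-two computation turns a suitable product of v and a power of
-- u into an element killed by p ^ s. So G is cyclic, except that the step from s = 1 needs p odd or e
-- ≥ 2, and the exception is the quaternion group.

open import Defs
open import Data.Bool using (Bool; true; false; _xor_)
open import Data.Empty using (⊥-elim)
open import Data.List using (List; []; _∷_; _++_; length; map; filter; cartesianProduct; upTo; applyUpTo)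
open import Data.List.Membership.Propositional using (_∈_; find)
open import Data.List.Membership.Propositional.Properties
open import Data.List.Properties
  using (filter-notAll; filter-none; filter-some; filter-≐; length-map; length-upTo; length-applyUpTo; length-++)
open import Data.List.Relation.Unary.All as All using (All; []; _∷_; all?)
open import Data.List.Relation.Unary.All.Properties using (¬Any⇒All¬; ¬All⇒Any¬)
open import Data.List.Relation.Unary.AllPairs using ([]; _∷_)
open import Data.List.Relation.Unary.Any as Any using (Any; here; there; any?)
open import Data.List.Relation.Unary.Unique.Propositional using (Unique)
import Data.List.Relation.Unary.Unique.Propositional.Properties as Uniq
open import Data.Nat hiding (_≟_)
import Data.Nat as ℕ using (_≟_)
open import Data.Nat.Coprimality as Cop using (Coprime; coprime-Bézout)
open import Data.Nat.Divisibility
open import Data.Nat.DivMod using (m≡m%n+[m/n]*n; m%n<n; _%_; _/_)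
open import Data.Nat.GCD using (module Bézout)
open import Data.Nat.Primality
open import Data.Nat.Properties hiding (_≟_)
open import Data.Nat.Solver using (module +-*-Solver)
open import Data.Product using (∃-syntax; _×_; _,_; proj₁; proj₂)
open import Data.Sum using (_⊎_; inj₁; inj₂)
open import Function using (id; _∘_)
open import Function.Definitions using (Surjective)
open import Relation.Binary.Definitions using (DecidableEquality; Symmetric; Transitive)
open import Relation.Binary.PropositionalEquality
open import Relation.Nullary
open import Relation.Nullary.Decidable using (map′)
open import Relation.Unary using (Decidable)
open import Algebra.Bundles using (Group)
import Algebra.Properties.Group as GroupProps

-- Counting in lists by injections, classes and fibres

private variable
  A B : Set

length-cartesianProduct : (xs : List A) (ys : List B) → length (cartesianProduct xs ys) ≡ length xs * length ys
length-cartesianProduct []       ys = refl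
length-cartesianProduct (x ∷ xs) ys = trans (length-++ (map (x ,_) ys))
  (cong₂ _+_ (length-map (x ,_) ys) (length-cartesianProduct xs ys))

-- Induction on `xs`: cut `f x` out of `ys`; by injectivity the rest of `xs` still maps into what
-- remains.
length-≤-inj : {xs : List A} {ys : List B} (f : A → B) → Unique xs →
  (∀ {x} → x ∈ xs → f x ∈ ys) →
  (∀ {x y} → x ∈ xs → y ∈ xs → f x ≡ f y → x ≡ y) →
  length xs ≤ length ys
length-≤-inj {xs = []} f _ _ _ = z≤n
length-≤-inj {A = A} {B = B} {xs = x ∷ xs} {ys} f (x≉ ∷ u) into inj
  with as , bs , refl ← ∈-∃++ (into (here refl)) = begin
    suc (length xs)               ≤⟨ s≤s (length-≤-inj f u into′ λ a b → inj (there a) (there b)) ⟩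
    suc (length (as ++ bs))       ≡⟨ cong suc (length-++ as) ⟩
    suc (length as + length bs)   ≡⟨ +-suc (length as) (length bs) ⟨
    length as + suc (length bs)   ≡⟨ length-++ as ⟨
    length (as ++ f x ∷ bs)       ∎
  where
  open ≤-Reasoning
  into′ : ∀ {y} → y ∈ xs → f y ∈ as ++ bs
  into′ y∈ with ∈-++⁻ as (into (there y∈))
  ... | inj₁ q          = ∈-++⁺ˡ q
  ... | inj₂ (here fy≡fx) = ⊥-elim (All.lookup x≉ y∈ (sym (inj (there y∈) (here refl) fy≡fx)))
  ... | inj₂ (there q)  = ∈-++⁺ʳ as q

module _ {P : A → Set} (P? : Decidable P) where

  length-filter-split : ∀ xs →
    length xs ≡ length (filter P? xs) + length (filter (λ x → ¬? (P? x)) xs)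
  length-filter-split [] = refl
  length-filter-split (x ∷ xs) with P? x
  ... | yes _ = cong suc (length-filter-split xs)
  ... | no  _ = trans (cong suc (length-filter-split xs)) (sym (+-suc _ _))

  filter-filter : {Q : A → Set} (Q? : Decidable Q) → (∀ {x} → Q x → P x) → ∀ xs →
    filter Q? (filter P? xs) ≡ filter Q? xs
  filter-filter Q? Q⇒P [] = refl
  filter-filter Q? Q⇒P (x ∷ xs) with P? x
  filter-filter Q? Q⇒P (x ∷ xs) | yes _ with Q? x
  ... | yes _ = cong (x ∷_) (filter-filter Q? Q⇒P xs)
  ... | no  _ = filter-filter Q? Q⇒P xs
  filter-filter Q? Q⇒P (x ∷ xs) | no ¬Px with Q? x
  ... | yes Qx = ⊥-elim (¬Px (Q⇒P Qx))
  ... | no  _  = filter-filter Q? Q⇒P xs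

-- Splitting off the class of the head leaves every other class whole. The bound `n` is fuel, since
-- the remaining list is a filter and not a subterm.
∣-length-classes : (d : ℕ) {R : A → A → Set} (R? : ∀ x y → Dec (R x y)) →
  (∀ x → R x x) → Symmetric R → Transitive R → ∀ n xs → length xs ≤ n →
  (∀ {x} → x ∈ xs → d ∣ length (filter (R? x) xs)) → d ∣ length xs
∣-length-classes d R? rfl sm tr n [] _ _ = d ∣0
∣-length-classes {A = A} d {R} R? rfl sm tr (suc n) xs@(x ∷ xs′) (s≤s le) h =
  subst (d ∣_) (sym (length-filter-split (R? x) xs))
    (∣m∣n⇒∣m+n (h (here refl)) (∣-length-classes d R? rfl sm tr n rest
      (≤-pred (≤-trans (filter-notAll (λ y → ¬? (R? x y)) xs (here λ k → k (rfl x))) (s≤s le))) h′))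
  where
  rest : List A
  rest = filter (λ y → ¬? (R? x y)) xs
  h′ : ∀ {y} → y ∈ rest → d ∣ length (filter (R? y) rest)
  h′ {y} y∈ with y∈xs , ¬xy ← ∈-filter⁻ (λ y → ¬? (R? x y)) {xs = xs} y∈ =
    subst (λ l → d ∣ length l)
      (sym (filter-filter (λ y → ¬? (R? x y)) (R? y) (λ yz xz → ¬xy (tr xz (sm yz))) xs)) (h y∈xs)

-- Serves orbit-stabiliser counting, with `φ` the map from acting pairs to an orbit.
length-fibres : (_≟_ : DecidableEquality B) (φ : A → B) (c : ℕ) {ys : List B} → Unique ys →
  ∀ xs → (∀ {x} → x ∈ xs → φ x ∈ ys) →
  (∀ {y} → y ∈ ys → length (filter (λ x → φ x ≟ y) xs) ≡ c) → length xs ≡ length ys * c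
length-fibres _≟_ φ c {[]} _ [] _ _ = refl
length-fibres _≟_ φ c {[]} _ (x ∷ xs) into _ with () ← into (here refl)
length-fibres {A = A} _≟_ φ c {y ∷ ys} (y≉ ∷ u) xs into h =
  trans (length-filter-split (λ x → φ x ≟ y) xs)
    (cong₂ _+_ (h (here refl)) (length-fibres _≟_ φ c u rest into′ h′))
  where
  rest : List A
  rest = filter (λ x → ¬? (φ x ≟ y)) xs
  into′ : ∀ {x} → x ∈ rest → φ x ∈ ys
  into′ x∈ with x∈xs , φx≢y ← ∈-filter⁻ (λ x → ¬? (φ x ≟ y)) {xs = xs} x∈ with into x∈xs
  ... | here e  = ⊥-elim (φx≢y e)
  ... | there q = q
  h′ : ∀ {y′} → y′ ∈ ys → length (filter (λ x → φ x ≟ y′) rest) ≡ c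
  h′ {y′} y′∈ = trans (cong length (filter-filter (λ x → ¬? (φ x ≟ y)) (λ x → φ x ≟ y′)
    (λ e e′ → All.lookup y≉ y′∈ (trans (sym e′) e)) xs)) (h (there y′∈))

-- Arithmetic of natural numbers and prime powers

least : {P : ℕ → Set} → Decidable P → ∀ n → P n → ∃[ m ] P m × (∀ j → j < m → ¬ P j)
least P? zero    p = 0 , p , λ _ ()
least P? (suc n) p with P? 0
... | yes p₀ = 0 , p₀ , λ _ ()
... | no ¬p₀ with m , pm , h ← least (P? ∘ suc) n p =
  suc m , pm , λ { zero _ → ¬p₀ ; (suc j) (s≤s lt) → h j lt }

-- `m` inverts `k` modulo `n`; multiples of `n` on both sides stand in for subtraction.
coprime-inverse : ∀ {k n} → Coprime k n → ∃[ m ] ∃[ i ] ∃[ j ] m * k + i * n ≡ 1 + j * n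
coprime-inverse {k} {n} c with coprime-Bézout c
... | Bézout.+- x y eq = x , 0 , y , trans (+-identityʳ (x * k)) (sym eq)
-- Here `x * k` is -1 modulo `n`, so -x, the inverse of `k`, is represented by `x * k * x`.
... | Bézout.-+ x y eq = x * k * x , y , x * k * y , (begin
    x * k * x * k + y * n         ≡⟨ cong (x * k * x * k +_) eq ⟨
    x * k * x * k + (1 + x * k)   ≡⟨ solve 2 (λ x k → x :* k :* x :* k :+ (con 1 :+ x :* k)
                                       := con 1 :+ x :* k :* (con 1 :+ x :* k)) refl x k ⟩
    1 + x * k * (1 + x * k)       ≡⟨ cong (λ t → 1 + x * k * t) eq ⟩
    1 + x * k * (y * n)           ≡⟨ cong suc (*-assoc (x * k) y n) ⟨
    1 + x * k * y * n             ∎)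
  where
  open ≡-Reasoning
  open +-*-Solver

-- The binomial coefficient n over 2, which is the exponent of the commutator in `class-two-↑`.
triangle : ℕ → ℕ
triangle zero    = 0
triangle (suc n) = n + triangle n

2*triangle : ∀ n → 2 * triangle n + n ≡ n * n
2*triangle zero    = refl
2*triangle (suc n) = begin
  2 * (n + triangle n) + suc n          ≡⟨ solve 2 (λ n t → con 2 :* (n :+ t) :+ (con 1 :+ n)
                                              := con 2 :* n :+ con 1 :+ (con 2 :* t :+ n)) refl n (triangle n) ⟩
  2 * n + 1 + (2 * triangle n + n)      ≡⟨ cong (2 * n + 1 +_) (2*triangle n) ⟩
  2 * n + 1 + n * n                     ≡⟨ solve 1 (λ n → con 2 :* n :+ con 1 :+ n :* n
                                              := (con 1 :+ n) :* (con 1 :+ n)) refl n ⟩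
  suc n * suc n                         ∎
  where
  open ≡-Reasoning
  open +-*-Solver

module PrimePowers (p : ℕ) (pr : Prime p) where

  instance
    p-nonZero : NonZero p
    p-nonZero = prime⇒nonZero pr

  1<p : 1 < p
  1<p = nonTrivial⇒n>1 p {{prime⇒nonTrivial pr}}

  ∤⇒coprime : ∀ {d} → p ∤ d → Coprime p d
  ∤⇒coprime p∤d (i∣p , i∣d) with prime⇒irreducible pr i∣p
  ... | inj₁ i≡1 = i≡1
  ... | inj₂ refl = ⊥-elim (p∤d i∣d)

  -- If `p` divides `d`, cancel it on both sides; otherwise `d` is coprime to `p` and already
  -- divides the smaller power.
  divisor-of-power : ∀ k {d} → d ∣ p ^ k → ∃[ i ] i ≤ k × d ≡ p ^ i
  divisor-of-power zero    d∣1 = 0 , z≤n , ∣1⇒≡1 d∣1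
  divisor-of-power (suc k) {d} d∣ with p ∣? d
  ... | no p∤d with i , le , eq ← divisor-of-power k (Cop.coprime-divisor (Cop.sym (∤⇒coprime p∤d)) d∣) =
    i , m≤n⇒m≤1+n le , eq
  ... | yes (divides q refl)
    with i , le , refl ← divisor-of-power k {q} (*-cancelˡ-∣ p (subst (_∣ p * p ^ k) (*-comm q p) d∣)) =
    suc i , s≤s le , *-comm (p ^ i) p

  ∤⇒coprime-power : ∀ {k} t → p ∤ k → Coprime k (p ^ t)
  ∤⇒coprime-power t p∤k (d∣k , d∣pᵗ) with divisor-of-power t d∣pᵗ
  ... | zero  , _ , eq   = eq
  ... | suc i , _ , refl = ⊥-elim (p∤k (∣-trans (m∣m*n (p ^ i)) d∣k))

  -- Twice the triangle is `p * p - p`, and an odd prime does not divide 2.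
  p∣triangle : p ≢ 2 → p ∣ triangle p
  p∣triangle p≢2 with euclidsLemma 2 (triangle p) pr
    (∣m+n∣m⇒∣n (subst (p ∣_) (trans (sym (2*triangle p)) (+-comm (2 * triangle p) p)) (m∣m*n p)) ∣-refl)
  ... | inj₁ p∣2 = ⊥-elim (p≢2 (≤-antisym (∣⇒≤ p∣2) 1<p))
  ... | inj₂ q   = q

  ^-mono-∣ : ∀ {i j} → i ≤ j → p ^ i ∣ p ^ j
  ^-mono-∣ {i} {j} le = subst (p ^ i ∣_)
    (trans (sym (^-distribˡ-+-* p i (j ∸ i))) (cong (p ^_) (m+[n∸m]≡n le))) (m∣m*n (p ^ (j ∸ i)))

  ^-cancel-< : ∀ {i j} → p ^ i < p ^ j → i < j
  ^-cancel-< {i} {j} lt with i <? j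
  ... | yes q = q
  ... | no ¬q = ⊥-elim (<-irrefl refl (<-≤-trans lt (^-monoʳ-≤ p (≮⇒≥ ¬q))))

  ^-cancel-≤ : ∀ {i j} → p ^ i ≤ p ^ j → i ≤ j
  ^-cancel-≤ {i} {j} le with i ≤? j
  ... | yes q = q
  ... | no ¬q = ⊥-elim (<⇒≱ (^-monoʳ-< p 1<p (≰⇒> ¬q)) le)

-- Powers of elements in a finite group

module Powers (G : FinGroup) where

  open FinGroup G public using () renaming
    ( Carrier to X; _≟_ to infix 4 _≟ˣ_; elems to els; complete to ∈els; unique to els!
    ; _∙_ to infixl 7 _·_; ε to 𝟏; _⁻¹ to inv; pow to infixr 8 _↑_; isGroup to isGrp)

  group : Group _ _
  group = record { isGroup = isGrp }

  open Group group public using (assoc; identityˡ; identityʳ; inverseˡ; inverseʳ)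
  open GroupProps group public using (∙-cancelˡ; ∙-cancelʳ; ⁻¹-anti-homo-∙; ⁻¹-involutive; ε⁻¹≈ε; inverseʳ-unique)

  Commute : X → X → Set
  Commute x y = x · y ≡ y · x

  ↑1 : ∀ x → x ↑ 1 ≡ x
  ↑1 x = identityʳ x

  𝟏↑ : ∀ n → 𝟏 ↑ n ≡ 𝟏
  𝟏↑ zero    = refl
  𝟏↑ (suc n) = trans (identityˡ _) (𝟏↑ n)

  ↑-+ : ∀ x m n → x ↑ (m + n) ≡ x ↑ m · x ↑ n
  ↑-+ x zero    n = sym (identityˡ _)
  ↑-+ x (suc m) n = trans (cong (x ·_) (↑-+ x m n)) (sym (assoc _ _ _))

  ↑↑ : ∀ x m n → (x ↑ m) ↑ n ≡ x ↑ (m * n)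
  ↑↑ x m zero    = cong (x ↑_) (sym (*-zeroʳ m))
  ↑↑ x m (suc n) = trans (cong (x ↑ m ·_) (↑↑ x m n))
    (trans (sym (↑-+ x m (m * n))) (cong (x ↑_) (sym (*-suc m n))))

  ↑-swap : ∀ x m n → (x ↑ m) ↑ n ≡ (x ↑ n) ↑ m
  ↑-swap x m n = trans (↑↑ x m n) (trans (cong (x ↑_) (*-comm m n)) (sym (↑↑ x n m)))

  ↑-𝟏-* : ∀ {x m} n → x ↑ m ≡ 𝟏 → x ↑ (m * n) ≡ 𝟏
  ↑-𝟏-* {x} {m} n e = trans (sym (↑↑ x m n)) (trans (cong (_↑ n) e) (𝟏↑ n))

  ↑-𝟏-∣ : ∀ {x m n} → m ∣ n → x ↑ m ≡ 𝟏 → x ↑ n ≡ 𝟏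
  ↑-𝟏-∣ {x} {m} (divides q refl) e = trans (cong (x ↑_) (*-comm q m)) (↑-𝟏-* {m = m} q e)

  commute-↑ : ∀ {x y} n → Commute x y → Commute x (y ↑ n)
  commute-↑ {x} zero c = trans (identityʳ x) (sym (identityˡ x))
  commute-↑ {x} {y} (suc n) c = begin
    x · (y · y ↑ n)   ≡⟨ assoc x y _ ⟨
    x · y · y ↑ n     ≡⟨ cong (_· y ↑ n) c ⟩
    y · x · y ↑ n     ≡⟨ assoc y x _ ⟩
    y · (x · y ↑ n)   ≡⟨ cong (y ·_) (commute-↑ n c) ⟩
    y · (y ↑ n · x)   ≡⟨ assoc y _ x ⟨
    y · y ↑ n · x     ∎
    where open ≡-Reasoning

  commute-powers : ∀ x m n → Commute (x ↑ m) (x ↑ n)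
  commute-powers x m n = commute-↑ n (sym (commute-↑ m refl))

  ↑-· : ∀ {x y} n → Commute x y → (x · y) ↑ n ≡ x ↑ n · y ↑ n
  ↑-· zero c = sym (identityˡ 𝟏)
  ↑-· {x} {y} (suc n) c = begin
    x · y · (x · y) ↑ n         ≡⟨ cong (x · y ·_) (↑-· n c) ⟩
    x · y · (x ↑ n · y ↑ n)     ≡⟨ assoc x y _ ⟩
    x · (y · (x ↑ n · y ↑ n))   ≡⟨ cong (x ·_) (assoc y _ _) ⟨
    x · (y · x ↑ n · y ↑ n)     ≡⟨ cong (λ t → x · (t · y ↑ n)) (commute-↑ n (sym c)) ⟩
    x · (x ↑ n · y · y ↑ n)     ≡⟨ cong (x ·_) (assoc _ y _) ⟩
    x · (x ↑ n · (y · y ↑ n))   ≡⟨ assoc x _ _ ⟨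
    x · x ↑ n · (y · y ↑ n)     ∎
    where open ≡-Reasoning

  -- Collecting commutators in class two

  module _ {u v c : X} (central : Central G c) (vu : v · u ≡ u · v · c) where
    open ≡-Reasoning

    private
      c↑ : ∀ n y → Commute y (c ↑ n)
      c↑ n y = commute-↑ n (sym (central y))

    -- Each `u` that `v` passes leaves behind one `c`, and the central `c` moves to the end.
    commutator-↑ʳ : ∀ n → v · u ↑ n ≡ u ↑ n · v · c ↑ n
    commutator-↑ʳ zero = begin
      v · 𝟏          ≡⟨ identityʳ v ⟩
      v              ≡⟨ identityˡ v ⟨
      𝟏 · v          ≡⟨ identityʳ _ ⟨
      𝟏 · v · 𝟏      ∎
    commutator-↑ʳ (suc n) = begin
      v · (u · u ↑ n)             ≡⟨ assoc v u _ ⟨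
      v · u · u ↑ n               ≡⟨ cong (_· u ↑ n) vu ⟩
      u · v · c · u ↑ n           ≡⟨ assoc _ c _ ⟩
      u · v · (c · u ↑ n)         ≡⟨ cong (u · v ·_) (central _) ⟩
      u · v · (u ↑ n · c)         ≡⟨ assoc u v _ ⟩
      u · (v · (u ↑ n · c))       ≡⟨ cong (u ·_) (assoc v _ c) ⟨
      u · (v · u ↑ n · c)         ≡⟨ cong (λ t → u · (t · c)) (commutator-↑ʳ n) ⟩
      u · (u ↑ n · v · c ↑ n · c) ≡⟨ cong (u ·_) (assoc _ _ c) ⟩
      u · (u ↑ n · v · (c ↑ n · c)) ≡⟨ cong (λ t → u · (u ↑ n · v · t)) (sym (c↑ n c)) ⟩
      u · (u ↑ n · v · c ↑ suc n) ≡⟨ assoc u _ _ ⟨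
      u · (u ↑ n · v) · c ↑ suc n ≡⟨ cong (_· c ↑ suc n) (assoc u _ v) ⟨
      u ↑ suc n · v · c ↑ suc n   ∎

    commutator-↑ˡ : ∀ n → v ↑ n · u ≡ u · v ↑ n · c ↑ n
    commutator-↑ˡ zero = begin
      𝟏 · u          ≡⟨ identityˡ u ⟩
      u              ≡⟨ identityʳ u ⟨
      u · 𝟏          ≡⟨ identityʳ _ ⟨
      u · 𝟏 · 𝟏      ∎
    commutator-↑ˡ (suc n) = begin
      v · v ↑ n · u               ≡⟨ assoc v _ u ⟩
      v · (v ↑ n · u)             ≡⟨ cong (v ·_) (commutator-↑ˡ n) ⟩
      v · (u · v ↑ n · c ↑ n)     ≡⟨ cong (v ·_) (assoc u _ _) ⟩
      v · (u · (v ↑ n · c ↑ n))   ≡⟨ assoc v u _ ⟨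
      v · u · (v ↑ n · c ↑ n)     ≡⟨ cong (_· (v ↑ n · c ↑ n)) vu ⟩
      u · v · c · (v ↑ n · c ↑ n) ≡⟨ assoc _ c _ ⟩
      u · v · (c · (v ↑ n · c ↑ n)) ≡⟨ cong (u · v ·_) (assoc c _ _) ⟨
      u · v · (c · v ↑ n · c ↑ n) ≡⟨ cong (λ t → u · v · (t · c ↑ n)) (central _) ⟩
      u · v · (v ↑ n · c · c ↑ n) ≡⟨ cong (u · v ·_) (assoc _ c _) ⟩
      u · v · (v ↑ n · c ↑ suc n) ≡⟨ assoc _ _ _ ⟨
      u · v · v ↑ n · c ↑ suc n   ≡⟨ cong (_· c ↑ suc n) (assoc u v _) ⟩
      u · v ↑ suc n · c ↑ suc n   ∎

    -- To collect the `u`s on the left, the successive `v`s pass n-1, ..., 1, 0 of them, which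
    -- releases `triangle n` copies of `c`.
    class-two-↑ : ∀ n → (u · v) ↑ n ≡ u ↑ n · v ↑ n · c ↑ triangle n
    class-two-↑ zero = trans (sym (identityˡ 𝟏)) (sym (identityʳ _))
    class-two-↑ (suc n) = begin
      u · v · (u · v) ↑ n
        ≡⟨ cong (u · v ·_) (class-two-↑ n) ⟩
      u · v · (u ↑ n · v ↑ n · c ↑ t)
        ≡⟨ cong (u · v ·_) (assoc _ _ _) ⟩
      u · v · (u ↑ n · (v ↑ n · c ↑ t))
        ≡⟨ assoc _ _ _ ⟨
      u · v · u ↑ n · (v ↑ n · c ↑ t)
        ≡⟨ cong (_· (v ↑ n · c ↑ t)) (assoc u v _) ⟩
      u · (v · u ↑ n) · (v ↑ n · c ↑ t)
        ≡⟨ cong (λ s → u · s · (v ↑ n · c ↑ t)) (commutator-↑ʳ n) ⟩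
      u · (u ↑ n · v · c ↑ n) · (v ↑ n · c ↑ t)
        ≡⟨ cong (_· (v ↑ n · c ↑ t)) (assoc u _ _) ⟨
      u · (u ↑ n · v) · c ↑ n · (v ↑ n · c ↑ t)
        ≡⟨ cong (λ s → s · c ↑ n · (v ↑ n · c ↑ t)) (assoc u _ v) ⟨
      u ↑ suc n · v · c ↑ n · (v ↑ n · c ↑ t)
        ≡⟨ assoc _ _ _ ⟩
      u ↑ suc n · v · (c ↑ n · (v ↑ n · c ↑ t))
        ≡⟨ cong (u ↑ suc n · v ·_) (assoc _ _ _) ⟨
      u ↑ suc n · v · (c ↑ n · v ↑ n · c ↑ t)
        ≡⟨ cong (λ s → u ↑ suc n · v · (s · c ↑ t)) (sym (c↑ n (v ↑ n))) ⟩
      u ↑ suc n · v · (v ↑ n · c ↑ n · c ↑ t)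
        ≡⟨ cong (u ↑ suc n · v ·_) (assoc _ _ _) ⟩
      u ↑ suc n · v · (v ↑ n · (c ↑ n · c ↑ t))
        ≡⟨ assoc _ _ _ ⟨
      u ↑ suc n · v · v ↑ n · (c ↑ n · c ↑ t)
        ≡⟨ cong₂ _·_ (assoc _ v _) (sym (↑-+ c n t)) ⟩
      u ↑ suc n · v ↑ suc n · c ↑ (n + t) ∎
      where
      t : ℕ
      t = triangle n

  -- Cyclic subgroups, orders and Lagrange's theorem

  ⟨_⟩ : X → X → Set
  ⟨ a ⟩ = InCyclic G a

  ⟨⟩-self : ∀ {a} → ⟨ a ⟩ a
  ⟨⟩-self {a} = 1 , sym (↑1 a)

  ⟨⟩-· : ∀ {a x y} → ⟨ a ⟩ x → ⟨ a ⟩ y → ⟨ a ⟩ (x · y)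
  ⟨⟩-· {a} (k , refl) (l , refl) = k + l , sym (↑-+ a k l)

  ⟨⟩-trans : ∀ {a x y} → ⟨ a ⟩ x → ⟨ x ⟩ y → ⟨ a ⟩ y
  ⟨⟩-trans {a} (k , refl) (l , refl) = k * l , ↑↑ a k l

  ⟨⟩-↑ : ∀ {a x} n → ⟨ a ⟩ x → ⟨ a ⟩ (x ↑ n)
  ⟨⟩-↑ n h = ⟨⟩-trans h (n , refl)

  inv-↑ : ∀ {x n} → x ↑ suc n ≡ 𝟏 → inv x ≡ x ↑ n
  inv-↑ {x} {n} e = sym (inverseʳ-unique x (x ↑ n) e)

  ↑-∸ : ∀ {x i j} → i ≤ j → x ↑ i ≡ x ↑ j → x ↑ (j ∸ i) ≡ 𝟏
  ↑-∸ {x} {i} {j} i≤j e = ∙-cancelˡ (x ↑ i) _ _ (begin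
    x ↑ i · x ↑ (j ∸ i)   ≡⟨ ↑-+ x i (j ∸ i) ⟨
    x ↑ (i + (j ∸ i))     ≡⟨ cong (x ↑_) (m+[n∸m]≡n i≤j) ⟩
    x ↑ j                 ≡⟨ e ⟨
    x ↑ i                 ≡⟨ identityʳ _ ⟨
    x ↑ i · 𝟏             ∎)
    where open ≡-Reasoning

  -- Equal powers differ by an exponent that kills `x`. Nothing is assumed about `x ↑ d`, so
  -- `torsion` can apply this before an order is known.
  equal-exponents : ∀ {x d} → (∀ {n} → n < d → x ↑ n ≡ 𝟏 → n ≡ 0) →
    ∀ {i j} → i < d → j < d → x ↑ i ≡ x ↑ j → i ≡ j
  equal-exponents {x} {d} h {i} {j} i<d j<d e with ≤-total i j
  ... | inj₁ i≤j = ≤-antisym i≤j (m∸n≡0⇒m≤n (h (≤-<-trans (m∸n≤m j i) j<d) (↑-∸ i≤j e)))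
  ... | inj₂ j≤i = ≤-antisym (m∸n≡0⇒m≤n (h (≤-<-trans (m∸n≤m i j) i<d) (↑-∸ j≤i (sym e)))) j≤i

  module Order {x : X} {d : ℕ} (ord : HasOrder G x d) where

    instance
      d-nonZero : NonZero d
      d-nonZero = >-nonZero (proj₁ ord)

    ↑d : x ↑ d ≡ 𝟏
    ↑d = proj₁ (proj₂ ord)

    ↑-% : ∀ n → x ↑ n ≡ x ↑ (n % d)
    ↑-% n = begin
      x ↑ n                              ≡⟨ cong (x ↑_) (m≡m%n+[m/n]*n n d) ⟩
      x ↑ (n % d + n / d * d)            ≡⟨ ↑-+ x (n % d) (n / d * d) ⟩
      x ↑ (n % d) · x ↑ (n / d * d)      ≡⟨ cong (x ↑ (n % d) ·_) (↑-𝟏-∣ (n∣m*n (n / d)) ↑d) ⟩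
      x ↑ (n % d) · 𝟏                    ≡⟨ identityʳ _ ⟩
      x ↑ (n % d)                        ∎
      where open ≡-Reasoning

    <-𝟏⇒0 : ∀ {n} → n < d → x ↑ n ≡ 𝟏 → n ≡ 0
    <-𝟏⇒0 {zero}  _  _ = refl
    <-𝟏⇒0 {suc n} lt e = ⊥-elim (proj₂ (proj₂ ord) (suc n) (s≤s z≤n) lt e)

    order-∣ : ∀ {n} → x ↑ n ≡ 𝟏 → d ∣ n
    order-∣ {n} e = divides (n / d) (trans (m≡m%n+[m/n]*n n d)
      (cong (_+ n / d * d) (<-𝟏⇒0 (m%n<n n d) (trans (sym (↑-% n)) e))))

    ↑-injective : ∀ {i j} → i < d → j < d → x ↑ i ≡ x ↑ j → i ≡ j
    ↑-injective {i} {j} i<d j<d e = equal-exponents (λ {n} → <-𝟏⇒0 {n}) i<d j<d e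

    bounded-exponent : ∀ {y} → ⟨ x ⟩ y → ∃[ k ] k < d × y ≡ x ↑ k
    bounded-exponent (k , e) = k % d , m%n<n k d , trans e (↑-% k)

    -- Exponents reduce modulo `d`, so a finite search decides membership.
    cyclic? : ∀ y → Dec (⟨ x ⟩ y)
    cyclic? y = map′ (λ (k , _ , e) → k , e) bounded-exponent (anyUpTo? (λ k → y ≟ˣ x ↑ k) d)

    -- `d` kills every power of `x`, so `y ↑ (d - 1)` is the inverse of `y`.
    ⟨⟩-inv : ∀ {y} → ⟨ x ⟩ y → ⟨ x ⟩ (inv y)
    ⟨⟩-inv {y} (k , refl) = ⟨⟩-trans {y = inv y} (k , refl) (pred d , inv-↑ {n = pred d}
      (trans (cong ((x ↑ k) ↑_) (suc-pred d)) (trans (↑-swap x k d) (trans (cong (_↑ k) ↑d) (𝟏↑ k)))))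

    private
      Coset : X → X → Set
      Coset y z = ⟨ x ⟩ (inv y · z)

      coset-eq : ∀ {y z w} → inv y · z ≡ w → z ≡ y · w
      coset-eq {y} {z} refl = sym (trans (sym (assoc y _ z)) (trans (cong (_· z) (inverseʳ y)) (identityˡ z)))

      coset-length : ∀ y → length (filter (λ z → cyclic? (inv y · z)) els) ≡ d
      coset-length y = ≤-antisym
        (subst (length coset ≤_) (trans (length-map (λ k → y · x ↑ k) (upTo d)) (length-upTo d))
          (length-≤-inj id (Uniq.filter⁺ _ els!) into λ _ _ e → e))
        (subst (_≤ length coset) (length-upTo d)
          (length-≤-inj (λ k → y · x ↑ k) (Uniq.upTo⁺ d) onto
            λ p q e → ↑-injective (∈-upTo⁻ p) (∈-upTo⁻ q) (∙-cancelˡ y _ _ e)))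
        where
        coset : List X
        coset = filter (λ z → cyclic? (inv y · z)) els
        into : ∀ {z} → z ∈ coset → z ∈ map (λ k → y · x ↑ k) (upTo d)
        into {z} z∈
          with k , k<d , e ← bounded-exponent (proj₂ (∈-filter⁻ (λ z → cyclic? (inv y · z)) {xs = els} z∈)) =
          subst (_∈ _) (sym (coset-eq e)) (∈-map⁺ (λ k → y · x ↑ k) (∈-upTo⁺ k<d))
        onto : ∀ {k} → k ∈ upTo d → y · x ↑ k ∈ coset
        onto {k} _ = ∈-filter⁺ _ (∈els _) (k , trans (sym (assoc _ y _))
          (trans (cong (_· x ↑ k) (inverseˡ y)) (identityˡ _)))

    cyclic-length : length (filter cyclic? els) ≡ d
    cyclic-length = trans (cong length (filter-≐ cyclic? (λ z → cyclic? (inv 𝟏 · z))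
      ((λ {z} → subst ⟨ x ⟩ (sym (shift z))) , λ {z} → subst ⟨ x ⟩ (shift z)) els)) (coset-length 𝟏)
      where
      shift : ∀ z → inv 𝟏 · z ≡ z
      shift z = trans (cong (_· z) ε⁻¹≈ε) (identityˡ z)

    -- The classes of `Coset` are the left cosets of ⟨x⟩, each of length `d` by `coset-length`.
    lagrange : d ∣ card G
    lagrange = ∣-length-classes d (λ y z → cyclic? (inv y · z))
      (λ y → 0 , inverseˡ y) sm tr (length els) els ≤-refl
      (λ {y} _ → subst (d ∣_) (sym (coset-length y)) ∣-refl)
      where
      sm : ∀ {y z} → Coset y z → Coset z y
      sm {y} {z} h = subst ⟨ x ⟩ (trans (⁻¹-anti-homo-∙ (inv y) z) (cong (inv z ·_) (⁻¹-involutive y))) (⟨⟩-inv h)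
      tr : ∀ {y z w} → Coset y z → Coset z w → Coset y w
      tr {y} {z} {w} h h′ = subst ⟨ x ⟩ (trans (assoc _ z _)
        (cong (inv y ·_) (trans (sym (assoc z _ w)) (trans (cong (_· w) (inverseʳ z)) (identityˡ w))))) (⟨⟩-· h h′)

  order-exists : ∀ {x n} → x ↑ suc n ≡ 𝟏 → ∃[ d ] HasOrder G x d
  order-exists {x} {n} e with m , em , h ← least (λ k → x ↑ suc k ≟ˣ 𝟏) n e =
    suc m , s≤s z≤n , em , λ { (suc j) _ (s≤s j<m) → h j j<m }

  -- If no exponent from 1 to `card G` killed `x`, there would be `card G + 1` distinct powers of
  -- `x`.
  torsion : ∀ x → ∃[ d ] HasOrder G x d
  torsion x with anyUpTo? (λ k → x ↑ suc k ≟ˣ 𝟏) (length els)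
  ... | yes (k , _ , e) = order-exists {n = k} e
  ... | no ¬e = ⊥-elim (<-irrefl refl (≤-trans
    (≤-reflexive (sym (length-upTo (suc (length els)))))
    (length-≤-inj (x ↑_) (Uniq.upTo⁺ (suc (length els))) (λ _ → ∈els _)
      λ p q → equal-exponents no-relation (∈-upTo⁻ p) (∈-upTo⁻ q))))
    where
    no-relation : ∀ {n} → n < suc (length els) → x ↑ n ≡ 𝟏 → n ≡ 0
    no-relation {zero}  _        _ = refl
    no-relation {suc n} (s≤s lt) e = ⊥-elim (¬e (n , lt , e))

-- Groups of prime-power exponent and the property 𝒫(p)

module ExponentPrimePower (p : ℕ) (pr : Prime p) (G : FinGroup) (K : ℕ)
  (exponent : ∀ x → pow G x (p ^ K) ≡ ε G) where

  open PrimePowers p pr public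
  open Powers G public

  ↑p^ : ∀ x i j → (x ↑ p ^ i) ↑ p ^ j ≡ x ↑ p ^ (i + j)
  ↑p^ x i j = trans (↑↑ x (p ^ i) (p ^ j)) (cong (x ↑_) (sym (^-distribˡ-+-* p i j)))

  ↑p^-mono : ∀ {x i j} → i ≤ j → x ↑ p ^ i ≡ 𝟏 → x ↑ p ^ j ≡ 𝟏
  ↑p^-mono i≤j = ↑-𝟏-∣ (^-mono-∣ i≤j)

  prime-power-order : ∀ {x} t → x ↑ p ^ suc t ≡ 𝟏 → x ↑ p ^ t ≢ 𝟏 → HasOrder G x (p ^ suc t)
  prime-power-order {x} t e ne with d , ord ← torsion x
    with i , i≤ , refl ← divisor-of-power (suc t) (Order.order-∣ ord e)
    with m≤n⇒m<n∨m≡n i≤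
  ... | inj₁ (s≤s i≤t) = ⊥-elim (ne (↑p^-mono i≤t (Order.↑d ord)))
  ... | inj₂ refl = ord

  -- `p ^ suc t` is the order of `x`, found as the least power of `p` that kills it.
  last-nontrivial : ∀ {x} j → x ↑ p ^ j ≢ 𝟏 → ∃[ t ] j ≤ t × x ↑ p ^ t ≢ 𝟏 × x ↑ p ^ suc t ≡ 𝟏
  last-nontrivial {x} j ne with least (λ n → x ↑ p ^ n ≟ˣ 𝟏) K (exponent x)
  ... | zero , e , _ = ⊥-elim (ne (↑p^-mono {i = 0} {j = j} z≤n e))
  ... | suc t , e , h with j ≤? t
  ...   | yes j≤t = t , j≤t , h t ≤-refl , e
  ...   | no j≰t  = ⊥-elim (ne (↑p^-mono {j = j} (≰⇒> j≰t) e))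

  -- If `x` has order `p ^ suc t`, then `x ↑ p ^ (t ∸ j)` has order `p ^ suc j`.
  power-of-order : ∀ {x} j → x ↑ p ^ j ≢ 𝟏 → ∃[ c ] ⟨ x ⟩ c × c ↑ p ^ j ≢ 𝟏 × c ↑ p ^ suc j ≡ 𝟏
  power-of-order {x} j ne with t , j≤t , ne′ , e ← last-nontrivial j ne =
    x ↑ p ^ (t ∸ j) , (p ^ (t ∸ j) , refl)
    , (λ e′ → ne′ (trans (cong (λ n → x ↑ p ^ n) (sym (m∸n+n≡m j≤t))) (trans (sym (↑p^ x (t ∸ j) j)) e′)))
    , trans (↑p^ x (t ∸ j) (suc j))
        (trans (cong (λ n → x ↑ p ^ n) (trans (+-suc (t ∸ j) j) (cong suc (m∸n+n≡m j≤t)))) e)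

  ↑-unroot : ∀ {x k n m i j} → x ↑ n ≡ 𝟏 → m * k + i * n ≡ 1 + j * n → (x ↑ k) ↑ m ≡ x
  ↑-unroot {x} {k} {n} {m} {i} {j} e eq = begin
    (x ↑ k) ↑ m                  ≡⟨ ↑↑ x k m ⟩
    x ↑ (k * m)                  ≡⟨ cong (x ↑_) (*-comm k m) ⟩
    x ↑ (m * k)                  ≡⟨ identityʳ _ ⟨
    x ↑ (m * k) · 𝟏              ≡⟨ cong (x ↑ (m * k) ·_) (↑-𝟏-∣ (n∣m*n i) e) ⟨
    x ↑ (m * k) · x ↑ (i * n)    ≡⟨ ↑-+ x (m * k) (i * n) ⟨
    x ↑ (m * k + i * n)          ≡⟨ cong (x ↑_) eq ⟩
    x · x ↑ (j * n)              ≡⟨ cong (x ·_) (↑-𝟏-∣ (n∣m*n j) e) ⟩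
    x · 𝟏                        ≡⟨ identityʳ x ⟩
    x                            ∎
    where open ≡-Reasoning

  -- The exponent of `w` over `a` is prime to `p`, since otherwise `p ^ s` would kill `w`; it is
  -- therefore invertible modulo `p ^ suc s`.
  generates : ∀ {a w} s → a ↑ p ^ suc s ≡ 𝟏 → ⟨ a ⟩ w → w ↑ p ^ s ≢ 𝟏 → ⟨ w ⟩ a
  generates {a} {w} s e (k , refl) ne with p ∣? k
  ... | yes (divides q refl) = ⊥-elim (ne (begin
    (a ↑ (q * p)) ↑ p ^ s    ≡⟨ ↑↑ a (q * p) (p ^ s) ⟩
    a ↑ (q * p * p ^ s)      ≡⟨ ↑-𝟏-∣ (subst (p ^ suc s ∣_) (sym (*-assoc q p _)) (n∣m*n q)) e ⟩
    𝟏                        ∎))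
    where open ≡-Reasoning
  ... | no p∤k with m , i , j , eq ← coprime-inverse (∤⇒coprime-power (suc s) p∤k) =
    m , sym (↑-unroot {m = m} {i} {j} e eq)

  -- With `m` inverse to `ℓ` modulo `p ^ K`, the maps `_↑ ℓ` and `_↑ m` undo each other.
  unique-root : ∀ {ℓ} → Coprime ℓ (p ^ K) → ∀ x → r G ℓ x ≡ 1
  unique-root {ℓ} c x with m , i , j , eq ← coprime-inverse c =
    ≤-antisym
      (length-≤-inj {ys = x ↑ m ∷ []} id (Uniq.filter⁺ _ els!) into λ _ _ e → e)
      (length-≤-inj {xs = x ↑ m ∷ []} id ([] ∷ []) onto λ _ _ e → e)
    where
    unroot : ∀ y → (y ↑ ℓ) ↑ m ≡ y
    unroot y = ↑-unroot {m = m} {i} {j} (exponent y) eq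
    into : ∀ {y} → y ∈ filter (λ g → g ↑ ℓ ≟ˣ x) els → y ∈ x ↑ m ∷ []
    into {y} y∈ with refl ← proj₂ (∈-filter⁻ (λ g → g ↑ ℓ ≟ˣ x) {xs = els} y∈) = here (sym (unroot y))
    onto : ∀ {y} → y ∈ x ↑ m ∷ [] → y ∈ filter (λ g → g ↑ ℓ ≟ˣ x) els
    onto (here refl) = ∈-filter⁺ _ (∈els _) (trans (↑-swap x m ℓ) (unroot x))

  no-roots : ∀ {a} → (∀ g → g ↑ p ≢ a) → r G p a ≡ 0
  no-roots {a} h = cong length (filter-none (λ g → g ↑ p ≟ˣ a) {els} (All.tabulate λ {g} _ → h g))

  -- Every `ℓ` strictly between 1 and `p` is prime to `p`, so both root counts are 1 and only p-th
  -- roots separate `a` from `b`.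
  satP : ∀ {a b} → SameOrder G a b → (∀ g → g ↑ p ≢ a) → ∃[ c ] c ↑ p ≡ b → SatP p G
  satP {a} {b} same h (c , e) = a , b , same , no-roots h
    , filter-some (λ g → g ↑ p ≟ˣ b) (Any.map (λ { refl → e }) (∈els c))
    , λ ℓ 1<ℓ ℓ<p _ → trans (roots ℓ 1<ℓ ℓ<p a) (sym (roots ℓ 1<ℓ ℓ<p b))
    where
    roots : ∀ ℓ → 1 < ℓ → ℓ < p → ∀ x → r G ℓ x ≡ 1
    roots ℓ 1<ℓ ℓ<p = unique-root (∤⇒coprime-power K
      λ p∣ℓ → <⇒≱ ℓ<p (∣⇒≤ {{>-nonZero (<-trans z<s 1<ℓ)}} p∣ℓ))

  -- Some power `c` of `h` has order `p ^ (t + 2)`, so `c ↑ p` is a p-th power of the same order as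
  -- `a`.
  satP-of-larger-order : ∀ {a h} t → a ↑ p ^ suc t ≡ 𝟏 → a ↑ p ^ t ≢ 𝟏 → (∀ g → g ↑ p ≢ a) →
    h ↑ p ^ suc t ≢ 𝟏 → SatP p G
  satP-of-larger-order {a} {h} t e ne nr ne′ with c , _ , cne , ce ← power-of-order (suc t) ne′ =
    satP (p ^ suc t , prime-power-order t e ne
           , prime-power-order t (trans (↑↑ c p (p ^ suc t)) ce) (λ q → cne (trans (sym (↑↑ c p (p ^ t))) q)))
      nr (c , refl)

-- The class equation modulo a central cyclic subgroup

module PGroup (p : ℕ) (pr : Prime p) (G : FinGroup) (K : ℕ) (card≡ : card G ≡ p ^ K) where

  private
    module P = Powers G

  exponent : ∀ x → pow G x (p ^ K) ≡ ε G
  exponent x with d , ord ← P.torsion x = P.↑-𝟏-∣ (subst (d ∣_) card≡ (P.Order.lagrange ord)) (P.Order.↑d ord)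

  open ExponentPrimePower p pr G K exponent public

  -- The group G × ⟨a⟩ acts on G by conjugation and translation; its orbits are the preimages in G
  -- of the conjugacy classes of G / ⟨a⟩.
  module CentralQuotient {a : X} {s : ℕ} (ord : HasOrder G a (p ^ s)) (central : Central G a) where

    open Order ord

    centralᶜ : ∀ {c} → ⟨ a ⟩ c → Central G c
    centralᶜ (k , refl) y = sym (commute-↑ k (sym (central y)))

    act : X × X → X → X
    act (g , c) x = g · x · inv g · c

    _⊙_ : X × X → X × X → X × X
    (h , d) ⊙ (g , c) = h · g , d · c

    invᵃ : X × X → X × X
    invᵃ (g , c) = inv g , inv c

    pairs : List (X × X)
    pairs = cartesianProduct els (filter cyclic? els)

    pairs! : Unique pairs
    pairs! = Uniq.cartesianProduct⁺ els! (Uniq.filter⁺ cyclic? els!)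

    ∈pairs : ∀ {g c} → ⟨ a ⟩ c → (g , c) ∈ pairs
    ∈pairs {g} {c} h = ∈-cartesianProduct⁺ (∈els g) (∈-filter⁺ cyclic? (∈els c) h)

    pairs-⟨⟩ : ∀ {q} → q ∈ pairs → ⟨ a ⟩ (proj₂ q)
    pairs-⟨⟩ {g , c} q∈ = proj₂ (∈-filter⁻ cyclic? {xs = els} (proj₂ (∈-cartesianProduct⁻ els (filter cyclic? els) q∈)))

    ⊙∈ : ∀ {q r} → q ∈ pairs → r ∈ pairs → q ⊙ r ∈ pairs
    ⊙∈ q∈ r∈ = ∈pairs (⟨⟩-· (pairs-⟨⟩ q∈) (pairs-⟨⟩ r∈))

    inv∈ : ∀ {q} → q ∈ pairs → invᵃ q ∈ pairs
    inv∈ q∈ = ∈pairs (⟨⟩-inv (pairs-⟨⟩ q∈))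

    act-⊙ : ∀ {q r x} → q ∈ pairs → r ∈ pairs → act q (act r x) ≡ act (q ⊙ r) x
    act-⊙ {h , d} {g , c} {x} q∈ r∈ = begin
      h · (g · x · inv g · c) · inv h · d   ≡⟨ cong (λ t → t · inv h · d) (assoc h _ c) ⟨
      h · (g · x · inv g) · c · inv h · d   ≡⟨ cong (_· d) (assoc _ c _) ⟩
      h · (g · x · inv g) · (c · inv h) · d ≡⟨ cong (λ t → h · (g · x · inv g) · t · d) (centralᶜ (pairs-⟨⟩ r∈) _) ⟩
      h · (g · x · inv g) · (inv h · c) · d ≡⟨ assoc _ _ d ⟩
      h · (g · x · inv g) · (inv h · c · d) ≡⟨ cong (h · (g · x · inv g) ·_) (assoc _ c d) ⟩
      h · (g · x · inv g) · (inv h · (c · d)) ≡⟨ assoc _ _ _ ⟨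
      h · (g · x · inv g) · inv h · (c · d)   ≡⟨ cong₂ _·_ conj (sym (centralᶜ (pairs-⟨⟩ q∈) c)) ⟩
      h · g · x · inv (h · g) · (d · c)     ∎
      where
      open ≡-Reasoning
      conj : h · (g · x · inv g) · inv h ≡ h · g · x · inv (h · g)
      conj = begin
        h · (g · x · inv g) · inv h     ≡⟨ cong (_· inv h) (assoc h _ _) ⟨
        h · (g · x) · inv g · inv h     ≡⟨ cong (λ t → t · inv g · inv h) (assoc h g x) ⟨
        h · g · x · inv g · inv h       ≡⟨ assoc _ _ _ ⟩
        h · g · x · (inv g · inv h)     ≡⟨ cong (h · g · x ·_) (⁻¹-anti-homo-∙ h g) ⟨
        h · g · x · inv (h · g)         ∎

    act-translation : ∀ c x → act (𝟏 , c) x ≡ x · c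
    act-translation c x = cong (_· c) (trans (cong (_· inv 𝟏) (identityˡ x)) (trans (cong (x ·_) ε⁻¹≈ε) (identityʳ x)))

    act-𝟏 : ∀ x → act (𝟏 , 𝟏) x ≡ x
    act-𝟏 x = trans (act-translation 𝟏 x) (identityʳ x)

    act-inv : ∀ {q x} → q ∈ pairs → act (invᵃ q) (act q x) ≡ x
    act-inv {g , c} {x} q∈ = trans (act-⊙ (inv∈ q∈) q∈)
      (trans (cong₂ (λ h d → act (h , d) x) (inverseˡ g) (inverseˡ c)) (act-𝟏 x))

    _~_ : X → X → Set
    x ~ y = Any (λ q → act q x ≡ y) pairs

    _~?_ : ∀ x y → Dec (x ~ y)
    x ~? y = any? (λ q → act q x ≟ˣ y) pairs

    mk~ : ∀ {x y q} → q ∈ pairs → act q x ≡ y → x ~ y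
    mk~ {x} {y} q∈ e = Any.map (λ { refl → e }) q∈

    ~-refl : ∀ x → x ~ x
    ~-refl x = mk~ (∈pairs (0 , refl)) (act-𝟏 x)

    ~-sym : ∀ {x y} → x ~ y → y ~ x
    ~-sym h with q , q∈ , refl ← find h = mk~ (inv∈ q∈) (act-inv q∈)

    ~-trans : ∀ {x y z} → x ~ y → y ~ z → x ~ z
    ~-trans h h′ with q , q∈ , refl ← find h | r , r∈ , refl ← find h′ = mk~ (⊙∈ r∈ q∈) (sym (act-⊙ r∈ q∈))

    -- Elements of ⟨a⟩ are central, so conjugation fixes them and translation stays in ⟨a⟩. Hence
    -- the complement of ⟨a⟩ is a union of orbits.
    ⟨⟩-~ : ∀ {x y} → ⟨ a ⟩ x → x ~ y → ⟨ a ⟩ y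
    ⟨⟩-~ {x} x∈ h with (g , c) , q∈ , refl ← find h = subst ⟨ a ⟩ (begin
      x · c                   ≡⟨ cong (_· c) (identityʳ x) ⟨
      x · 𝟏 · c               ≡⟨ cong (λ t → x · t · c) (inverseʳ g) ⟨
      x · (g · inv g) · c     ≡⟨ cong (_· c) (assoc x g _) ⟨
      x · g · inv g · c       ≡⟨ cong (λ t → t · inv g · c) (centralᶜ x∈ g) ⟩
      g · x · inv g · c       ∎) (⟨⟩-· x∈ (pairs-⟨⟩ q∈))
      where open ≡-Reasoning

    transporters : X → X → List (X × X)
    transporters x y = filter (λ q → act q x ≟ˣ y) pairs

    -- Left multiplication by a pair taking `y` to `z` is injective. By symmetry all fibres over one
    -- orbit have equal length.
    transporters-≤ : ∀ {x y z} → y ~ z → length (transporters x y) ≤ length (transporters x z)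
    transporters-≤ {x} {y} {z} h with q@(h , d) , q∈ , refl ← find h =
      length-≤-inj (q ⊙_) (Uniq.filter⁺ _ pairs!) into
        λ _ _ e → cong₂ _,_ (∙-cancelˡ h _ _ (cong proj₁ e)) (∙-cancelˡ d _ _ (cong proj₂ e))
      where
      into : ∀ {r} → r ∈ transporters x y → q ⊙ r ∈ transporters x z
      into r∈ with r∈pairs , refl ← ∈-filter⁻ (λ r → act r x ≟ˣ y) {xs = pairs} r∈ =
        ∈-filter⁺ (λ r → act r x ≟ˣ z) (⊙∈ q∈ r∈pairs) (sym (act-⊙ q∈ r∈pairs))

    outside : List X
    outside = filter (λ y → ¬? (cyclic? y)) els

    orbit : X → List X
    orbit x = filter (x ~?_) outside

    module _ {x} (x∉ : ¬ ⟨ a ⟩ x) where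

      ∈orbit : ∀ {q} → q ∈ pairs → act q x ∈ orbit x
      ∈orbit q∈ = ∈-filter⁺ (x ~?_)
        (∈-filter⁺ (λ y → ¬? (cyclic? y)) (∈els _) (λ h → x∉ (⟨⟩-~ h (~-sym (mk~ q∈ refl))))) (mk~ q∈ refl)

      -- Orbit length times the stabiliser length is the length of `pairs`, which is
      -- `p ^ K * p ^ s`.
      orbit-divides : length (orbit x) ∣ p ^ (K + s)
      orbit-divides = subst (length (orbit x) ∣_)
        (trans (sym (length-fibres _≟ˣ_ (λ q → act q x) (length (transporters x x))
            (Uniq.filter⁺ _ (Uniq.filter⁺ _ els!)) pairs ∈orbit
            λ y∈ → let x~y = proj₂ (∈-filter⁻ (x ~?_) {xs = outside} y∈) in
              ≤-antisym (transporters-≤ (~-sym x~y)) (transporters-≤ x~y)))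
          (trans (length-cartesianProduct els (filter cyclic? els))
            (trans (cong₂ _*_ card≡ cyclic-length) (sym (^-distribˡ-+-* p K s)))))
        (m∣m*n (length (transporters x x)))

      -- The orbit contains the `p ^ s` translates `x · a ↑ k`, and `w` is one more element.
      orbit-large : ∀ {w} → w ∈ orbit x → (∀ k → w ≢ x · a ↑ k) → p ^ s < length (orbit x)
      orbit-large {w} w∈ w≢ = subst (_≤ length (orbit x)) (cong suc (length-applyUpTo xa (p ^ s)))
        (length-≤-inj id
          (All.tabulate (λ m e → let k , _ , e′ = ∈-applyUpTo⁻ xa m in w≢ k (trans e e′))
            ∷ Uniq.applyUpTo⁺₁ xa (p ^ s) λ i<j j<d e →
                <⇒≢ i<j (↑-injective (<-trans i<j j<d) j<d (∙-cancelˡ x _ _ e)))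
          into λ _ _ e → e)
        where
        xa : ℕ → X
        xa k = x · a ↑ k
        into : ∀ {y} → y ∈ w ∷ applyUpTo xa (p ^ s) → y ∈ orbit x
        into (here refl) = w∈
        into (there m) with k , _ , refl ← ∈-applyUpTo⁻ xa m =
          subst (_∈ orbit x) (act-translation (a ↑ k) x) (∈orbit (∈pairs (k , refl)))

      orbit-divisible : ∀ {w} → w ∈ orbit x → (∀ k → w ≢ x · a ↑ k) → p ^ suc s ∣ length (orbit x)
      orbit-divisible w∈ w≢ with length (orbit x) | orbit-divides | orbit-large w∈ w≢
      ... | _ | div | large with i , _ , refl ← divisor-of-power (K + s) div = ^-mono-∣ {suc s} {i} (^-cancel-< {s} {i} large)

    -- Otherwise every orbit outside ⟨a⟩ is larger than a coset, so `p ^ suc s` divides the total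
    -- `p ^ K - p ^ s`. It also divides `p ^ K`, so it would divide `p ^ s`.
    central-mod : ∃[ x ] ¬ ⟨ a ⟩ x → ∃[ u ] ¬ ⟨ a ⟩ u × (∀ g → ∃[ k ] g · u ≡ u · g · a ↑ k)
    central-mod (x , x∉) with any? (λ u → ¬? (cyclic? u) ×-dec all? (λ g → cyclic? (inv (u · g) · (g · u))) els) els
    ... | yes found with u , _ , u∉ , h ← find found =
      u , u∉ , λ g → let k , e = All.lookup h (∈els g) in
        k , trans (sym (trans (sym (assoc (u · g) _ _))
              (trans (cong (_· (g · u)) (inverseʳ (u · g))) (identityˡ _)))) (cong (u · g ·_) e)
    ... | no ¬found = ⊥-elim (<⇒≱ (^-monoʳ-< p 1<p (n<1+n s)) (∣⇒≤ {{m^n≢0 p s}} div))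
      where
      orbit-div : ∀ {y} → y ∈ outside → p ^ suc s ∣ length (orbit y)
      orbit-div {y} y∈
        with y∉ ← proj₂ (∈-filter⁻ (λ y → ¬? (cyclic? y)) {xs = els} y∈)
        with g , _ , ng ← find (¬All⇒Any¬ (λ g → cyclic? (inv (y · g) · (g · y))) els
               λ h → ¬found (Any.map (λ { refl → y∉ , h }) (∈els y))) =
        -- The extra orbit element is the conjugate of `y` by `g`: were it `y · a ↑ k`, the
        -- commutator would lie in ⟨a⟩, against the choice of `g`.
        orbit-divisible y∉ (∈orbit y∉ {g , 𝟏} (∈pairs (0 , refl))) λ k e → ng (k , (begin
          inv (y · g) · (g · y)                   ≡⟨ cong (λ t → inv (y · g) · t) (begin
              g · y                               ≡⟨ identityʳ _ ⟨
              g · y · 𝟏                           ≡⟨ cong (g · y ·_) (inverseˡ g) ⟨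
              g · y · (inv g · g)                 ≡⟨ assoc _ _ g ⟨
              g · y · inv g · g                   ≡⟨ cong (_· g) (trans (sym (identityʳ _)) e) ⟩
              y · a ↑ k · g                       ≡⟨ assoc y _ g ⟩
              y · (a ↑ k · g)                     ≡⟨ cong (y ·_) (centralᶜ (k , refl) g) ⟩
              y · (g · a ↑ k)                     ≡⟨ assoc y g _ ⟨
              y · g · a ↑ k                       ∎) ⟩
          inv (y · g) · (y · g · a ↑ k)           ≡⟨ assoc _ _ _ ⟨
          inv (y · g) · (y · g) · a ↑ k           ≡⟨ cong (_· a ↑ k) (inverseˡ _) ⟩
          𝟏 · a ↑ k                               ≡⟨ identityˡ _ ⟩
          a ↑ k                                   ∎))
        where open ≡-Reasoning
      div-outside : p ^ suc s ∣ length outside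
      div-outside = ∣-length-classes (p ^ suc s) _~?_ ~-refl ~-sym ~-trans (length outside) outside ≤-refl orbit-div
      total : length outside + p ^ s ≡ p ^ K
      total = trans (+-comm (length outside) (p ^ s))
        (trans (cong (_+ length outside) (sym cyclic-length)) (trans (sym (length-filter-split cyclic? els)) card≡))
      s<K : s < K
      s<K = ^-cancel-< {s} {K} (subst (p ^ s <_) total (m<n+m (p ^ s)
        (≤-<-trans z≤n (filter-some′ (Any.map (λ { refl → x∉ }) (∈els x))))))
        where
        filter-some′ = filter-some (λ y → ¬? (cyclic? y)) {els}
      div : p ^ suc s ∣ p ^ s
      div = ∣m+n∣m⇒∣n (subst (p ^ suc s ∣_) (sym total) (^-mono-∣ s<K)) div-outside

-- Cyclic torsion when elements killed by p ^ e have p-th roots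

module ExactExponent (p : ℕ) (pr : Prime p) (G : FinGroup) (K : ℕ) (card≡ : card G ≡ p ^ K)
  (e : ℕ) (exponent-1+e : ∀ x → pow G x (p ^ suc e) ≡ ε G)
  (full : Carrier G) (full↑≢ : pow G full (p ^ e) ≢ ε G) where

  open PGroup p pr G K card≡ public

  module Rooted (root : ∀ x → x ↑ p ^ e ≡ 𝟏 → ∃[ y ] y ↑ p ≡ x) where

    -- A `p ^ t`-th root of `x` is killed by `p ^ suc t`; while `t < e` it is killed by `p ^ e`, and
    -- `root` goes one step deeper.
    iterated-root : ∀ t {x} → t ≤ e → x ↑ p ≡ 𝟏 → ∃[ y ] y ↑ p ^ t ≡ x
    iterated-root zero {x} _ _ = x , ↑1 x
    iterated-root (suc t) {x} t<e x↑p with y , refl ← iterated-root t (<⇒≤ t<e) x↑p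
      with w , refl ← root y (↑p^-mono {i = suc t} t<e (trans (sym (↑↑ y p (p ^ t))) (trans (↑-swap y p (p ^ t)) x↑p))) =
      w , sym (↑↑ w p (p ^ t))

    -- Take p-th roots until one has full order `p ^ suc e`. For `t = suc e` the second alternative
    -- forces `x ≡ 𝟏`.
    covered-or-root : ∀ t x → (∃[ y ] ⟨ y ⟩ x × y ↑ p ^ e ≢ 𝟏) ⊎ (∃[ y ] y ↑ p ^ t ≡ x)
    covered-or-root zero x = inj₂ (x , ↑1 x)
    covered-or-root (suc t) x with covered-or-root t x
    ... | inj₁ found = inj₁ found
    ... | inj₂ (y , refl) with y ↑ p ^ e ≟ˣ 𝟏
    ...   | no ne = inj₁ (y , (p ^ t , refl) , ne)
    ...   | yes y↑ with w , refl ← root y y↑ = inj₂ (w , sym (↑↑ w p (p ^ t)))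

    module RankOne (z : X) (z-order : HasOrder G z p) (socle : ∀ x → ⟨ z ⟩ (x ↑ p ^ e)) where

      CyclicTorsion : ℕ → X → Set
      CyclicTorsion s a = HasOrder G a (p ^ s) × (∀ x → x ↑ p ^ s ≡ 𝟏 → ⟨ a ⟩ x)

      -- An element killed by `p` is a `p ^ e`-th power by `iterated-root`, so `socle` places it in
      -- ⟨z⟩.
      cyclicTorsion-1 : CyclicTorsion 1 z
      cyclicTorsion-1 = subst (HasOrder G z) (sym (*-identityʳ p)) z-order , λ x x↑ →
        let y , e′ = iterated-root e ≤-refl (trans (cong (x ↑_) (sym (*-identityʳ p))) x↑)
        in subst ⟨ z ⟩ e′ (socle y)

      -- Every element lies in a cyclic group of order p ^ suc e, and that group contains a.
      cyclicTorsion-central : ∀ {s a} → s ≤ e → CyclicTorsion (suc s) a → Central G a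
      cyclicTorsion-central {s} {a} s≤e (ord , all) x with covered-or-root (suc e) x
      ... | inj₂ (y , e′) with refl ← trans (sym (exponent-1+e y)) e′ = trans (identityʳ a) (sym (identityˡ a))
      ... | inj₁ (y , (k , refl) , ne)
        with l , refl ← ⟨⟩-trans {y} (p ^ (e ∸ s) , refl) (generates s (Order.↑d ord)
               (all (y ↑ p ^ (e ∸ s)) (trans (↑p^ y (e ∸ s) (suc s))
                 (trans (cong (λ n → y ↑ p ^ n) (trans (+-suc (e ∸ s) s) (cong suc (m∸n+n≡m s≤e)))) (exponent-1+e y))))
               λ q → ne (trans (cong (λ n → y ↑ p ^ n) (sym (m∸n+n≡m s≤e))) (trans (sym (↑p^ y (e ∸ s) s)) q))) =
        commute-powers y l k

      module Step (big : p ≢ 2 ⊎ 2 ≤ e) {s : ℕ} {a : X} (s<e : s < e) (ct : CyclicTorsion (suc s) a) where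

        a-order : HasOrder G a (p ^ suc s)
        a-order = proj₁ ct

        open Order a-order using (cyclic?; ↑d)
        open CentralQuotient {a} {suc s} a-order (cyclicTorsion-central (<⇒≤ s<e) ct) using (centralᶜ; central-mod)

        ⟨a⟩-↑ : ∀ {x} → ⟨ a ⟩ x → x ↑ p ^ suc s ≡ 𝟏
        ⟨a⟩-↑ (k , refl) = trans (↑-swap a k (p ^ suc s)) (trans (cong (_↑ k) ↑d) (𝟏↑ k))

        full∉ : ¬ ⟨ a ⟩ full
        full∉ h = full↑≢ (↑p^-mono s<e (⟨a⟩-↑ h))

        -- The image of `u` is central in G / ⟨a⟩; the commutator `c` is explicit for use in the
        -- class-two formulas.
        NormalMod : X → Set
        NormalMod u = ∀ g → ∃[ c ] ⟨ a ⟩ c × g · u ≡ u · g · c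

        normalMod-↑ : ∀ {u} n → NormalMod u → NormalMod (u ↑ n)
        normalMod-↑ n h g with c , c∈ , eq ← h g = c ↑ n , ⟨⟩-↑ n c∈ , commutator-↑ʳ (centralᶜ c∈) eq n

        -- Of the iterated p-th powers of an element central modulo ⟨a⟩, the last one outside ⟨a⟩
        -- has order `p` modulo ⟨a⟩ and is still central there.
        generator : ∃[ u ] ¬ ⟨ a ⟩ u × ⟨ a ⟩ (u ↑ p) × NormalMod u
        generator with u , u∉ , h ← central-mod (full , full∉)
          with least (λ t → cyclic? (u ↑ p ^ t)) K (0 , exponent u)
        ... | zero , u∈ , _ = ⊥-elim (u∉ (subst ⟨ a ⟩ (↑1 u) u∈))
        ... | suc j , u↑∈ , min = u ↑ p ^ j , min j ≤-refl
          , subst ⟨ a ⟩ (trans (sym (↑↑ u p (p ^ j))) (↑-swap u p (p ^ j))) u↑∈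
          , normalMod-↑ (p ^ j) λ g → let k , eq = h g in a ↑ k , (k , refl) , eq

        module _ {U v : X} (normal : NormalMod U) (v↑ : v ↑ p ^ suc (suc s) ≡ 𝟏)
          (U∈ : ⟨ a ⟩ (U ↑ p)) (Uv : U ↑ p · v ↑ p ≡ 𝟏) where

          c : X
          c = proj₁ (normal v)

          c∈ : ⟨ a ⟩ c
          c∈ = proj₁ (proj₂ (normal v))

          vU : v · U ≡ U · v · c
          vU = proj₂ (proj₂ (normal v))

          -- `U ↑ p` lies in the central ⟨a⟩, so its commutator with `v`, which is `c ↑ p`, is
          -- trivial.
          c↑p : c ↑ p ≡ 𝟏
          c↑p = ∙-cancelˡ (U ↑ p · v) _ _ (begin
            U ↑ p · v · c ↑ p   ≡⟨ commutator-↑ʳ (centralᶜ c∈) vU p ⟨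
            v · U ↑ p           ≡⟨ centralᶜ U∈ v ⟨
            U ↑ p · v           ≡⟨ identityʳ _ ⟨
            U ↑ p · v · 𝟏       ∎)
            where open ≡-Reasoning

          product-↑p : (U · v) ↑ p ≡ c ↑ triangle p
          product-↑p = trans (class-two-↑ (centralᶜ c∈) vU p) (trans (cong (_· c ↑ triangle p) Uv) (identityˡ _))

          ↑p⇒↑p^ : ∀ {x} t → x ↑ p ≡ 𝟏 → x ↑ p ^ suc t ≡ 𝟏
          ↑p⇒↑p^ t = ↑-𝟏-* {m = p} (p ^ t)

          product-torsion : (U · v) ↑ p ^ suc s ≡ 𝟏
          product-torsion = cases big s refl
            where
            open ≡-Reasoning
            cases : p ≢ 2 ⊎ 2 ≤ e → ∀ t → s ≡ t → (U · v) ↑ p ^ suc t ≡ 𝟏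
            -- For odd `p`, `triangle p` is a multiple of `p` and the power of `c` in `product-↑p`
            -- vanishes.
            cases (inj₁ p≢2) t _ = ↑p⇒↑p^ t (trans product-↑p (↑-𝟏-∣ (p∣triangle p≢2) c↑p))
            -- For `s ≥ 1` a further p-th power is available and kills the power of `c`.
            cases (inj₂ _) (suc t) _ = trans (sym (↑↑ (U · v) p (p ^ suc t)))
              (↑p⇒↑p^ t (trans (cong (_↑ p) product-↑p)
                (trans (↑-swap c (triangle p) p) (trans (cong (_↑ triangle p) c↑p) (𝟏↑ (triangle p))))))
            -- For `s ≡ 0`, `v` is killed by `p ^ 2` and so has a p-th root `y`. The commutator of
            -- `y` and `U` is killed by `p`, so `v = y ↑ p` commutes with `U`.
            cases (inj₂ 2≤e) zero s≡
              with y , y↑p ← root v (↑p^-mono {i = 2} 2≤e (subst (λ t → v ↑ p ^ suc (suc t) ≡ 𝟏) s≡ v↑))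
              with d , d∈ , eq ← normal y = ↑p⇒↑p^ 0 (trans (↑-· p (sym (begin
                v · U                 ≡⟨ cong (_· U) y↑p ⟨
                y ↑ p · U             ≡⟨ commutator-↑ˡ (centralᶜ d∈) eq p ⟩
                U · y ↑ p · d ↑ p     ≡⟨ cong (U · y ↑ p ·_) (subst (λ n → d ↑ n ≡ 𝟏) (*-identityʳ p)
                                           (subst (λ t → d ↑ p ^ suc t ≡ 𝟏) s≡ (⟨a⟩-↑ d∈))) ⟩
                U · y ↑ p · 𝟏         ≡⟨ identityʳ _ ⟩
                U · y ↑ p             ≡⟨ cong (U ·_) y↑p ⟩
                U · v                 ∎))) Uv)

        -- `u ↑ p` generates ⟨a⟩, so `v ↑ p` is the p-th power of some `u ↑ n`. A power `U` of `u`
        -- with `U ↑ p` inverse to `v ↑ p` brings `U · v` into ⟨a⟩, which lies in ⟨u⟩.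
        step : ∃[ u ] CyclicTorsion (suc (suc s)) u
        step with u , u∉ , u↑p∈ , normal ← generator = u , u-order , generated
          where
          u↑≢ : u ↑ p ^ suc s ≢ 𝟏
          u↑≢ q = u∉ (proj₂ ct u q)
          u-order : HasOrder G u (p ^ suc (suc s))
          u-order = prime-power-order (suc s) (trans (sym (↑↑ u p (p ^ suc s))) (⟨a⟩-↑ u↑p∈)) u↑≢
          a∈⟨u↑p⟩ : ⟨ u ↑ p ⟩ a
          a∈⟨u↑p⟩ = generates s ↑d u↑p∈ λ q → u↑≢ (trans (sym (↑↑ u p (p ^ s))) q)
          generated : ∀ v → v ↑ p ^ suc (suc s) ≡ 𝟏 → ⟨ u ⟩ v
          generated v v↑ = subst ⟨ u ⟩ (trans (sym (assoc _ U v)) (trans (cong (_· v) (inverseˡ U)) (identityˡ v)))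
            (⟨⟩-· (Order.⟨⟩-inv u-order U∈⟨u⟩) (⟨⟩-trans (⟨⟩-trans (p , refl) a∈⟨u↑p⟩)
              (proj₂ ct (U · v) (product-torsion (normalMod-↑ N (normalMod-↑ n normal)) v↑
                (subst ⟨ a ⟩ (sym U↑p) (⟨⟩-↑ N v↑p∈)) Uv))))
            where
            v↑p∈ : ⟨ a ⟩ (v ↑ p)
            v↑p∈ = proj₂ ct (v ↑ p) (trans (↑↑ v p (p ^ suc s)) v↑)
            n N : ℕ
            n = proj₁ (⟨⟩-trans a∈⟨u↑p⟩ v↑p∈)
            -- This is -1 modulo `p ^ suc s`, so `U ↑ p` is the inverse of `v ↑ p`.
            N = pred (p ^ suc s)
            U : X
            U = (u ↑ n) ↑ N
            U∈⟨u⟩ : ⟨ u ⟩ U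
            U∈⟨u⟩ = ⟨⟩-↑ N (n , refl)
            U↑p : U ↑ p ≡ (v ↑ p) ↑ N
            U↑p = trans (↑-swap (u ↑ n) N p) (cong (_↑ N) (trans (↑-swap u n p)
              (sym (proj₂ (⟨⟩-trans a∈⟨u↑p⟩ v↑p∈)))))
            Uv : U ↑ p · v ↑ p ≡ 𝟏
            Uv = begin
              U ↑ p · v ↑ p               ≡⟨ cong (_· v ↑ p) U↑p ⟩
              (v ↑ p) ↑ N · v ↑ p         ≡⟨ commute-↑ N refl ⟨
              (v ↑ p) ↑ suc N             ≡⟨ cong ((v ↑ p) ↑_) (suc-pred (p ^ suc s) {{m^n≢0 p (suc s)}}) ⟩
              (v ↑ p) ↑ p ^ suc s         ≡⟨ ⟨a⟩-↑ v↑p∈ ⟩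
              𝟏                           ∎
              where open ≡-Reasoning

      cyclicTorsion : p ≢ 2 ⊎ 2 ≤ e → ∀ s → s ≤ e → ∃[ a ] CyclicTorsion (suc s) a
      cyclicTorsion big zero    _   = z , cyclicTorsion-1
      cyclicTorsion big (suc s) s<e = Step.step big s<e (proj₂ (cyclicTorsion big s (<⇒≤ s<e)))

      -- At `s = e` the torsion is all of G, which is therefore cyclic.
      abelian : p ≢ 2 ⊎ 2 ≤ e → Abelian G
      abelian big x y with a , _ , all ← cyclicTorsion big e ≤-refl
        with k , refl ← all x (exponent-1+e x) | l , refl ← all y (exponent-1+e y) = commute-powers a k l

-- Recognising the quaternion group

module Quaternion (G : FinGroup) (z : Carrier G) (z²≡ : _∙_ G z z ≡ ε G) (z≢ : z ≢ ε G) (z-central : Central G z)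
  (square : ∀ x → _∙_ G x x ≡ ε G ⊎ _∙_ G x x ≡ z)
  (involution : ∀ x → _∙_ G x x ≡ ε G → x ≡ ε G ⊎ x ≡ z) where

  open Powers G

  -- An element squaring to `𝟏` is `𝟏` or `z`, hence central.
  square≡z : ∀ {x y} → x · y ≢ y · x → x · x ≡ z
  square≡z {x} {y} nc with square x
  ... | inj₂ e = e
  ... | inj₁ e with involution x e
  ...   | inj₁ refl = ⊥-elim (nc (trans (identityˡ y) (sym (identityʳ y))))
  ...   | inj₂ refl = ⊥-elim (nc (z-central y))

  module _ {i j : X} (nc : i · j ≢ j · i) where
    open ≡-Reasoning

    k : X
    k = i · j

    ii : i · i ≡ z
    ii = square≡z nc

    jj : j · j ≡ z
    jj = square≡z (λ e → nc (sym e))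

    -- If `k` commuted with `i`, cancelling `i` on the left would make `i` and `j` commute.
    kk : k · k ≡ z
    kk = square≡z {k} {i} λ e → nc (∙-cancelˡ i _ _ (trans (sym e) (assoc i j i)))

    ki : k · i ≡ j
    ki = ∙-cancelʳ j _ _ (trans (assoc k i j) (trans kk (sym jj)))

    jk : j · k ≡ i
    jk = ∙-cancelˡ i _ _ (trans (sym (assoc i j k)) (trans kk (sym ii)))

    ik : i · k ≡ z · j
    ik = trans (sym (assoc i i j)) (cong (_· j) ii)

    kj : k · j ≡ z · i
    kj = trans (assoc i j j) (trans (cong (i ·_) jj) (sym (z-central i)))

    -- Multiplied by `j` on the right, both sides become `i`, by `jk` and `kj`.
    ji : j · i ≡ z · k
    ji = ∙-cancelʳ j _ _ (begin
      j · i · j       ≡⟨ assoc j i j ⟩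
      j · k           ≡⟨ jk ⟩
      i               ≡⟨ identityˡ i ⟨
      𝟏 · i           ≡⟨ cong (_· i) z²≡ ⟨
      z · z · i       ≡⟨ assoc z z i ⟩
      z · (z · i)     ≡⟨ cong (z ·_) kj ⟨
      z · (k · j)     ≡⟨ assoc z k j ⟨
      z · k · j       ∎)

    sign : Bool → X
    sign false = 𝟏
    sign true  = z

    sign-central : ∀ s x → sign s · x ≡ x · sign s
    sign-central false x = trans (identityˡ x) (sym (identityʳ x))
    sign-central true  x = z-central x

    sign-xor : ∀ s t → sign (s xor t) ≡ sign s · sign t
    sign-xor false t     = sym (identityˡ _)
    sign-xor true  false = sym (identityʳ z)
    sign-xor true  true  = sym z²≡

    sign-square : ∀ s → sign s · sign s ≡ 𝟏
    sign-square false = identityˡ 𝟏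
    sign-square true  = z²≡

    sign-injective : ∀ s t → sign s ≡ sign t → s ≡ t
    sign-injective false false _ = refl
    sign-injective false true  e = ⊥-elim (z≢ (sym e))
    sign-injective true  false e = ⊥-elim (z≢ e)
    sign-injective true  true  _ = refl

    interchange : ∀ s t x y → (sign s · x) · (sign t · y) ≡ sign s · sign t · (x · y)
    interchange s t x y = begin
      sign s · x · (sign t · y)       ≡⟨ assoc (sign s) x _ ⟩
      sign s · (x · (sign t · y))     ≡⟨ cong (sign s ·_) (assoc x _ y) ⟨
      sign s · (x · sign t · y)       ≡⟨ cong (λ w → sign s · (w · y)) (sign-central t x) ⟨
      sign s · (sign t · x · y)       ≡⟨ cong (sign s ·_) (assoc _ x y) ⟩
      sign s · (sign t · (x · y))     ≡⟨ assoc _ _ _ ⟨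
      sign s · sign t · (x · y)       ∎

    square-sign : ∀ s x → (sign s · x) · (sign s · x) ≡ x · x
    square-sign s x = trans (interchange s s x x) (trans (cong (_· (x · x)) (sign-square s)) (identityˡ _))

    unit : QU → X
    unit 𝟙 = 𝟏
    unit 𝕚 = i
    unit 𝕛 = j
    unit 𝕜 = k

    unit-· : ∀ u v → unit u · unit v ≡ sign (proj₁ (qmulU u v)) · unit (proj₂ (qmulU u v))
    unit-· 𝟙 v = refl
    unit-· 𝕚 𝟙 = trans (identityʳ i) (sym (identityˡ i))
    unit-· 𝕛 𝟙 = trans (identityʳ j) (sym (identityˡ j))
    unit-· 𝕜 𝟙 = trans (identityʳ k) (sym (identityˡ k))
    unit-· 𝕚 𝕚 = trans ii (sym (identityʳ z))
    unit-· 𝕛 𝕛 = trans jj (sym (identityʳ z))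
    unit-· 𝕜 𝕜 = trans kk (sym (identityʳ z))
    unit-· 𝕚 𝕛 = sym (identityˡ k)
    unit-· 𝕛 𝕚 = ji
    unit-· 𝕛 𝕜 = trans jk (sym (identityˡ i))
    unit-· 𝕜 𝕛 = kj
    unit-· 𝕜 𝕚 = trans ki (sym (identityˡ j))
    unit-· 𝕚 𝕜 = ik

    unit-square : ∀ u → u ≢ 𝟙 → unit u · unit u ≡ z
    unit-square 𝟙 u≢ = ⊥-elim (u≢ refl)
    unit-square 𝕚 _  = ii
    unit-square 𝕛 _  = jj
    unit-square 𝕜 _  = kk

    -- A product other than `𝟙` squares to `z`, which is how `f-injective` detects that two units
    -- differ.
    equal-or-product : ∀ u v → u ≡ v ⊎ proj₂ (qmulU u v) ≢ 𝟙
    equal-or-product 𝟙 𝟙 = inj₁ refl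
    equal-or-product 𝟙 𝕚 = inj₂ λ ()
    equal-or-product 𝟙 𝕛 = inj₂ λ ()
    equal-or-product 𝟙 𝕜 = inj₂ λ ()
    equal-or-product 𝕚 𝟙 = inj₂ λ ()
    equal-or-product 𝕚 𝕚 = inj₁ refl
    equal-or-product 𝕚 𝕛 = inj₂ λ ()
    equal-or-product 𝕚 𝕜 = inj₂ λ ()
    equal-or-product 𝕛 𝟙 = inj₂ λ ()
    equal-or-product 𝕛 𝕚 = inj₂ λ ()
    equal-or-product 𝕛 𝕛 = inj₁ refl
    equal-or-product 𝕛 𝕜 = inj₂ λ ()
    equal-or-product 𝕜 𝟙 = inj₂ λ ()
    equal-or-product 𝕜 𝕚 = inj₂ λ ()
    equal-or-product 𝕜 𝕛 = inj₂ λ ()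
    equal-or-product 𝕜 𝕜 = inj₁ refl

    unit-self : ∀ u → ∃[ s ] unit u · unit u ≡ sign s
    unit-self 𝟙 = false , identityˡ 𝟏
    unit-self 𝕚 = true , ii
    unit-self 𝕛 = true , jj
    unit-self 𝕜 = true , kk

    f : Q8 → X
    f (s , u) = sign s · unit u

    f-hom : ∀ x y → f (q8mul x y) ≡ f x · f y
    f-hom (s , u) (t , v) = begin
      sign ((s xor t) xor c) · unit w           ≡⟨ cong (_· unit w) (sign-xor (s xor t) c) ⟩
      sign (s xor t) · sign c · unit w          ≡⟨ assoc _ _ _ ⟩
      sign (s xor t) · (sign c · unit w)        ≡⟨ cong₂ _·_ (sign-xor s t) (sym (unit-· u v)) ⟩
      sign s · sign t · (unit u · unit v)       ≡⟨ interchange s t (unit u) (unit v) ⟨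
      sign s · unit u · (sign t · unit v)       ∎
      where
      c : Bool
      c = proj₁ (qmulU u v)
      w : QU
      w = proj₂ (qmulU u v)

    -- For u ≠ v the element f (s , u) · unit v squares to z, whereas f (t , v) · unit v squares to 𝟏.
    f-injective : ∀ {x y} → f x ≡ f y → x ≡ y
    f-injective {s , u} {t , v} e with equal-or-product u v
    ... | inj₁ refl = cong (_, u) (sign-injective s t (∙-cancelʳ (unit u) _ _ e))
    ... | inj₂ w≢ with d , vv ← unit-self v = ⊥-elim (z≢ (begin
      z                                           ≡⟨ unit-square w w≢ ⟨
      unit w · unit w                             ≡⟨ square-sign c (unit w) ⟨
      sq (sign c · unit w)                        ≡⟨ cong sq (unit-· u v) ⟨
      sq (unit u · unit v)                        ≡⟨ square-sign s _ ⟨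
      sq (sign s · (unit u · unit v))             ≡⟨ cong sq (assoc _ _ _) ⟨
      sq (sign s · unit u · unit v)               ≡⟨ cong (λ x → sq (x · unit v)) e ⟩
      sq (sign t · unit v · unit v)               ≡⟨ cong sq (assoc _ _ _) ⟩
      sq (sign t · (unit v · unit v))             ≡⟨ square-sign t _ ⟩
      sq (unit v · unit v)                        ≡⟨ cong sq vv ⟩
      sq (sign d)                                 ≡⟨ sign-square d ⟩
      𝟏                                           ∎))
      where
      sq : X → X
      sq x = x · x
      c : Bool
      c = proj₁ (qmulU u v)
      w : QU
      w = proj₂ (qmulU u v)

    q8s : List Q8
    q8s = cartesianProduct (false ∷ true ∷ []) (𝟙 ∷ 𝕚 ∷ 𝕛 ∷ 𝕜 ∷ [])

    q8s! : Unique q8s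
    q8s! = Uniq.cartesianProduct⁺ (((λ ()) ∷ []) ∷ [] ∷ [])
      (((λ ()) ∷ (λ ()) ∷ (λ ()) ∷ []) ∷ ((λ ()) ∷ (λ ()) ∷ []) ∷ ((λ ()) ∷ []) ∷ [] ∷ [])

    -- `f` has eight distinct values; an element missed by it would be a ninth.
    f-surjective : card G ≡ 8 → ∀ y → ∃[ x ] f x ≡ y
    f-surjective card≡8 y with any? (λ x → f x ≟ˣ y) q8s
    ... | yes found = Any.satisfied found
    ... | no ¬found = ⊥-elim (<⇒≱ (n<1+n 8) (subst (9 ≤_) card≡8
      (length-≤-inj {xs = y ∷ map f q8s} id
        (All.tabulate (λ m e → let x , x∈ , e′ = ∈-map⁻ f m in
            ¬found (Any.map (λ { refl → trans (sym e′) (sym e) }) x∈))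
          ∷ Uniq.map⁺ f-injective q8s!)
        (λ _ → ∈els _) λ _ _ e → e)))

    isoQ8 : card G ≡ 8 → IsoQ8 G
    isoQ8 card≡8 = f , f-injective
      , (λ y → let x , e = f-surjective card≡8 y in x , λ { refl → e }) , f-hom

-- Homomorphisms and retracts

module Hom {G H : FinGroup} {f : Carrier G → Carrier H} (hom : IsHom G H f) where

  private
    module G = Powers G
    module H = Powers H

  ε-homo : f (ε G) ≡ ε H
  ε-homo = H.∙-cancelˡ (f (ε G)) _ _ (trans (sym (hom _ _)) (trans (cong f (G.identityʳ _)) (sym (H.identityʳ _))))

  pow-homo : ∀ x n → f (pow G x n) ≡ pow H (f x) n
  pow-homo x zero    = ε-homo
  pow-homo x (suc n) = trans (hom _ _) (cong (_∙_ H (f x)) (pow-homo x n))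

module _ {G : FinGroup} where
  open Powers G

  r>0⇒root : ∀ ℓ {b} → 0 < r G ℓ b → ∃[ c ] c ↑ ℓ ≡ b
  r>0⇒root ℓ {b} lt with any? (λ g → g ↑ ℓ ≟ˣ b) els
  ... | yes found = Any.satisfied found
  ... | no ¬found = ⊥-elim (<⇒≢ lt (sym (cong length (filter-none (λ g → g ↑ ℓ ≟ˣ b) (¬Any⇒All¬ els ¬found)))))

  r≡0⇒no-root : ∀ ℓ {a} → r G ℓ a ≡ 0 → ∀ g → g ↑ ℓ ≢ a
  r≡0⇒no-root ℓ {a} eq g e =
    <⇒≢ (filter-some (λ g → g ↑ ℓ ≟ˣ a) (Any.map (λ { refl → e }) (∈els g))) (sym eq)

-- `ι` preserves orders and p-th roots, while `π` would carry a p-th root of `ι a` back to one of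
-- `a`. The counts for smaller `ℓ` come afresh from the exponent of `H`.
satP-retract : ∀ {p} → Prime p → (G H : FinGroup) (K : ℕ) → (∀ x → pow H x (p ^ K) ≡ ε H) →
  (ι : Carrier G → Carrier H) (π : Carrier H → Carrier G) → IsHom G H ι → IsHom H G π → (∀ x → π (ι x) ≡ x) →
  SatP p G → SatP p H
satP-retract {p} pr G H K exponent ι π ι-hom π-hom πι (a , b , (k , a-order , b-order) , ra , rb , _)
  with c , e ← r>0⇒root {G} p rb =
  ExponentPrimePower.satP p pr H K exponent (k , ι-order a-order , ι-order b-order)
    (λ g e′ → r≡0⇒no-root {G} p ra (π g) (trans (sym (π.pow-homo g p)) (trans (cong π e′) (πι a))))
    (ι c , trans (sym (ι.pow-homo c p)) (cong ι e))
  where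
  module ι = Hom {G} {H} {ι} ι-hom
  module π = Hom {H} {G} {π} π-hom
  ι-order : ∀ {x k} → HasOrder G x k → HasOrder H (ι x) k
  ι-order {x} {k} (1≤k , e , min) = 1≤k , trans (sym (ι.pow-homo x k)) (trans (cong ι e) ι.ε-homo)
    , λ j 1≤j j<k e′ → min j 1≤j j<k
        (trans (sym (πι _)) (trans (cong π (trans (ι.pow-homo x j) e′)) π.ε-homo))

-- The exponent, and the choice between p-th roots and 𝒫(p)

module NonAbelianPGroup (p : ℕ) (pr : Prime p) (G : FinGroup) (K : ℕ) (card≡ : card G ≡ p ^ K)
  (nonAbelian : NonAbelian G) where

  open PGroup p pr G K card≡

  -- The exponent of G is `p ^ suc e`, attained by `full`; it is a positive power because a
  -- non-abelian group is not trivial.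
  record Height : Set where
    constructor height
    field
      e         : ℕ
      exponent-1+e : ∀ x → x ↑ p ^ suc e ≡ 𝟏
      full      : X
      full↑≢    : full ↑ p ^ e ≢ 𝟏

  height-exists : Height
  height-exists with least (λ n → all? (λ x → x ↑ p ^ n ≟ˣ 𝟏) els) K (All.tabulate λ {x} _ → exponent x)
  ... | zero , all , _ = ⊥-elim (nonAbelian λ x y → trans (trivial (x · y)) (sym (trivial (y · x))))
    where
    trivial : ∀ x → x ≡ 𝟏
    trivial x = trans (sym (↑1 x)) (All.lookup all (∈els x))
  ... | suc e , all , min
    with x , x↑≢ ← Any.satisfied (¬All⇒Any¬ (λ x → x ↑ p ^ e ≟ˣ 𝟏) els (min e ≤-refl)) =
    height e (λ x → All.lookup all (∈els x)) x x↑≢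

module Dichotomy (p : ℕ) (pr : Prime p) (G : FinGroup) (K : ℕ) (card≡ : card G ≡ p ^ K)
  (e : ℕ) (exponent-1+e : ∀ x → pow G x (p ^ suc e) ≡ ε G)
  (full : Carrier G) (full↑≢ : pow G full (p ^ e) ≢ ε G) where

  open ExactExponent p pr G K card≡ e exponent-1+e full full↑≢

  e-maximal : ∀ {x} j → x ↑ p ^ j ≢ 𝟏 → j ≤ e
  e-maximal {x} j ne with j ≤? e
  ... | yes j≤e = j≤e
  ... | no j≰e  = ⊥-elim (ne (↑p^-mono (≰⇒> j≰e) (exponent-1+e x)))

  large-height : ∀ {g} m → HasOrder G g (p ^ suc m) → m ≤ e
  large-height m ord = e-maximal m (proj₂ (proj₂ ord) (p ^ m) (m^n>0 p m) (^-monoʳ-< p 1<p (n<1+n m)))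

  -- An element killed by `p ^ e` has smaller order than `full`, so if it is not a p-th power,
  -- `satP-of-larger-order` applies.
  roots-or-satP : (∀ x → x ↑ p ^ e ≡ 𝟏 → ∃[ y ] y ↑ p ≡ x) ⊎ SatP p G
  roots-or-satP with any? (λ a → (a ↑ p ^ e ≟ˣ 𝟏) ×-dec all? (λ g → ¬? (g ↑ p ≟ˣ a)) els) els
  ... | yes found with a , a↑ , none ← Any.satisfied found
    -- `a` is not `𝟏`, because `𝟏` is its own p-th power.
    with t , _ , a↑≢ , a↑≡ ← last-nontrivial {a} 0
           (λ a↑0 → All.lookup none (∈els 𝟏) (trans (𝟏↑ p) (trans (sym a↑0) (↑1 a)))) =
    inj₂ (satP-of-larger-order {h = full} t a↑≡ a↑≢ (λ g → All.lookup none (∈els g))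
      λ q → full↑≢ (↑p^-mono {i = suc t} {e} (≰⇒> λ e≤t → a↑≢ (↑p^-mono e≤t a↑)) q))
  roots-or-satP | no ¬found = inj₁ root
    where
    root : ∀ x → x ↑ p ^ e ≡ 𝟏 → ∃[ y ] y ↑ p ≡ x
    root x x↑ with any? (λ g → g ↑ p ≟ˣ x) els
    ... | yes has = Any.satisfied has
    ... | no none = ⊥-elim (¬found (Any.map (λ { refl → x↑ , ¬Any⇒All¬ els none }) (∈els x)))

  -- If `p` kills `x ↑ k`, then `p ^ suc e` divides `k * p`, hence `p ^ e` divides `k`.
  socle-generated : ∀ {x c} → HasOrder G x (p ^ suc e) → ⟨ x ⟩ c → c ↑ p ^ 1 ≡ 𝟏 → ⟨ x ↑ p ^ e ⟩ c
  socle-generated {x} ord (k , refl) c↑ = quotient p^e∣k , (begin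
    x ↑ k                           ≡⟨ cong (x ↑_) (_∣_.equality p^e∣k) ⟩
    x ↑ (quotient p^e∣k * p ^ e)    ≡⟨ cong (x ↑_) (*-comm _ (p ^ e)) ⟩
    x ↑ (p ^ e * quotient p^e∣k)    ≡⟨ ↑↑ x (p ^ e) _ ⟨
    (x ↑ p ^ e) ↑ quotient p^e∣k    ∎)
    where
    open ≡-Reasoning
    p^e∣k : p ^ e ∣ k
    p^e∣k = *-cancelʳ-∣ p (subst₂ _∣_ (*-comm p (p ^ e)) (cong (k *_) (*-identityʳ p))
      (Order.order-∣ ord (trans (sym (↑↑ x k (p ^ 1))) c↑)))

  socle-↑p : ∀ x → (x ↑ p ^ e) ↑ p ^ 1 ≡ 𝟏
  socle-↑p x = trans (↑p^ x e 1) (trans (cong (λ n → x ↑ p ^ n) (+-comm e 1)) (exponent-1+e x))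

  full-order : HasOrder G full (p ^ suc e)
  full-order = prime-power-order e (exponent-1+e full) full↑≢

  z : X
  z = full ↑ p ^ e

  z-order : HasOrder G z p
  z-order = subst (HasOrder G z) (*-identityʳ p)
    (prime-power-order 0 (socle-↑p full) λ q → full↑≢ (trans (sym (↑1 z)) q))

  -- If y ↑ p ^ e is not in ⟨ z ⟩, the p ^ (2 e + 2) products full ↑ i · y ↑ j are distinct.
  small-socle : K < suc e + suc e → ∀ y → ⟨ z ⟩ (y ↑ p ^ e)
  small-socle K< y with Order.cyclic? z-order (y ↑ p ^ e)
  ... | yes y∈ = y∈
  ... | no y∉ = ⊥-elim (<⇒≱ (^-monoʳ-< p 1<p K<) (subst₂ _≤_
      (trans (length-cartesianProduct (upTo N) (upTo N))
        (trans (cong₂ _*_ (length-upTo N) (length-upTo N)) (sym (^-distribˡ-+-* p (suc e) (suc e)))))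
      card≡
      (length-≤-inj (λ (i , j) → full ↑ i · y ↑ j) (Uniq.cartesianProduct⁺ (Uniq.upTo⁺ N) (Uniq.upTo⁺ N))
        (λ _ → ∈els _) λ ij∈ ij′∈ → injective (bounds ij∈) (bounds ij′∈))))
    where
    N : ℕ
    N = p ^ suc e
    y-order : HasOrder G y N
    y-order = prime-power-order e (exponent-1+e y) λ q → y∉ (0 , q)
    bounds : ∀ {i j} → (i , j) ∈ cartesianProduct (upTo N) (upTo N) → i < N × j < N
    bounds m with i∈ , j∈ ← ∈-cartesianProduct⁻ (upTo N) (upTo N) m = ∈-upTo⁻ i∈ , ∈-upTo⁻ j∈
    trivial-intersection : ∀ {w} → ⟨ full ⟩ w → ⟨ y ⟩ w → w ≡ 𝟏
    trivial-intersection {w} w∈full w∈y with w ≟ˣ 𝟏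
    ... | yes w≡ = w≡
    -- Some power `c` of `w` has order `p`. It lies in ⟨z⟩ and generates ⟨y ↑ p ^ e⟩, against `y∉`.
    ... | no w≢ with c , c∈ , c≢ , c↑ ← power-of-order {w} 0 (λ q → w≢ (trans (sym (↑1 w)) q)) =
      ⊥-elim (y∉ (⟨⟩-trans (socle-generated full-order (⟨⟩-trans w∈full c∈) c↑)
        (generates 0 (socle-↑p y) (socle-generated y-order (⟨⟩-trans w∈y c∈) c↑) c≢)))
    injective : ∀ {i j i′ j′} → i < N × j < N → i′ < N × j′ < N →
      full ↑ i · y ↑ j ≡ full ↑ i′ · y ↑ j′ → (i , j) ≡ (i′ , j′)
    injective {i} {j} {i′} {j′} (i< , j<) (i′< , j′<) eq = cong₂ _,_
      i≡i′ (Order.↑-injective y-order j< j′< (∙-cancelˡ (full ↑ i) _ _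
        (trans eq (cong (λ n → full ↑ n · y ↑ j′) (sym i≡i′)))))
      where
      open ≡-Reasoning
      -- Separating the variables exhibits an element common to ⟨full⟩ and ⟨y⟩.
      w≡ : inv (full ↑ i′) · full ↑ i ≡ y ↑ j′ · inv (y ↑ j)
      w≡ = ∙-cancelʳ (y ↑ j) _ _ (begin
        inv (full ↑ i′) · full ↑ i · y ↑ j       ≡⟨ assoc _ _ _ ⟩
        inv (full ↑ i′) · (full ↑ i · y ↑ j)     ≡⟨ cong (inv (full ↑ i′) ·_) eq ⟩
        inv (full ↑ i′) · (full ↑ i′ · y ↑ j′)   ≡⟨ assoc _ _ _ ⟨
        inv (full ↑ i′) · full ↑ i′ · y ↑ j′     ≡⟨ cong (_· y ↑ j′) (inverseˡ _) ⟩
        𝟏 · y ↑ j′                               ≡⟨ identityˡ _ ⟩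
        y ↑ j′                                   ≡⟨ identityʳ _ ⟨
        y ↑ j′ · 𝟏                               ≡⟨ cong (y ↑ j′ ·_) (inverseˡ _) ⟨
        y ↑ j′ · (inv (y ↑ j) · y ↑ j)           ≡⟨ assoc _ _ _ ⟨
        y ↑ j′ · inv (y ↑ j) · y ↑ j             ∎)
      w-trivial : inv (full ↑ i′) · full ↑ i ≡ 𝟏
      w-trivial = trivial-intersection
        (⟨⟩-· (Order.⟨⟩-inv full-order (i′ , refl)) (i , refl))
        (subst ⟨ y ⟩ (sym w≡) (⟨⟩-· (j′ , refl) (Order.⟨⟩-inv y-order (j , refl))))
      i≡i′ : i ≡ i′
      i≡i′ = Order.↑-injective full-order i< i′<
        (∙-cancelˡ (inv (full ↑ i′)) _ _ (trans w-trivial (sym (inverseˡ _))))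

  -- The quotient by ⟨α⟩ and the direct product

  module Quotient {H : FinGroup} {α : X} (α-order : HasOrder G α p) (α-central : Central G α)
    (f : X → Carrier H) (hom : IsHom G H f) (surjective : Surjective _≡_ _≡_ f)
    (kernel : ∀ g → (f g ≡ ε H → ⟨ α ⟩ g) × (⟨ α ⟩ g → f g ≡ ε H)) where

    open Hom {G} {H} {f} hom

    private
      module H = Powers H

    exponentᴴ : ∀ h → h H.↑ p ^ K ≡ H.𝟏
    exponentᴴ h with x , fx ← surjective h with refl ← fx refl =
      trans (sym (pow-homo x (p ^ K))) (trans (cong f (exponent x)) ε-homo)

    module _ (1≤e : 1 ≤ e) {β : X} (β↑ : β ↑ p ^ e ≡ α) where

      α≢𝟏 : α ≢ 𝟏
      α≢𝟏 q = proj₂ (proj₂ α-order) 1 ≤-refl 1<p (trans (↑1 α) q)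

      fβ↑≡ : f β H.↑ p ^ e ≡ H.𝟏
      fβ↑≡ = trans (sym (pow-homo β (p ^ e))) (proj₂ (kernel _) (subst ⟨ α ⟩ (sym β↑) ⟨⟩-self))

      ⟨α⟩-↑p : ∀ k → (α ↑ k) ↑ p ≡ 𝟏
      ⟨α⟩-↑p k = trans (↑-swap α k p) (trans (cong (_↑ k) (Order.↑d α-order)) (𝟏↑ k))

      -- `i` stands for `e - 1`. Were the power trivial, `β ↑ p ^ i` would lie in ⟨α⟩ and its p-th
      -- power `α` would be `𝟏`.
      fβ↑≢ : ∀ i → suc i ≡ e → f β H.↑ p ^ i ≢ H.𝟏
      fβ↑≢ i i≡ q with k , eq ← proj₁ (kernel _) (trans (pow-homo β (p ^ i)) q) =
        α≢𝟏 (begin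
          α                       ≡⟨ β↑ ⟨
          β ↑ p ^ e               ≡⟨ cong (λ n → β ↑ p ^ n) i≡ ⟨
          β ↑ p ^ suc i           ≡⟨ ↑↑ β p (p ^ i) ⟨
          (β ↑ p) ↑ p ^ i         ≡⟨ ↑-swap β p (p ^ i) ⟩
          (β ↑ p ^ i) ↑ p         ≡⟨ cong (_↑ p) eq ⟩
          (α ↑ k) ↑ p             ≡⟨ ⟨α⟩-↑p k ⟩
          𝟏                       ∎)
        where open ≡-Reasoning

      -- A root of f β would lift to γ with γ ↑ p = α ↑ k · β, whence γ ↑ p ^ suc e = α.
      fβ-no-root : ∀ g → g H.↑ p ≢ f β
      fβ-no-root g q with γ , fγ ← surjective g with refl ← fγ refl
        with k , eq ← proj₁ (kernel (γ ↑ p · inv β)) (trans (hom _ _)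
               (trans (cong (λ t → t H.· f (inv β)) (trans (pow-homo γ p) q))
                 (trans (sym (hom _ _)) (trans (cong f (inverseʳ β)) ε-homo)))) =
        α≢𝟏 (begin
          α                               ≡⟨ β↑ ⟨
          β ↑ p ^ e                       ≡⟨ identityˡ _ ⟨
          𝟏 · β ↑ p ^ e                   ≡⟨ cong (_· β ↑ p ^ e) (↑p^-mono 1≤e
                                               (trans (cong ((α ↑ k) ↑_) (*-identityʳ p)) (⟨α⟩-↑p k))) ⟨
          (α ↑ k) ↑ p ^ e · β ↑ p ^ e     ≡⟨ ↑-· (p ^ e) (sym (commute-↑ k (sym (α-central β)))) ⟨
          (α ↑ k · β) ↑ p ^ e             ≡⟨ cong (λ t → (t · β) ↑ p ^ e) eq ⟨
          (γ ↑ p · inv β · β) ↑ p ^ e     ≡⟨ cong (_↑ p ^ e) (trans (assoc _ _ β)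
                                               (trans (cong (γ ↑ p ·_) (inverseˡ β)) (identityʳ _))) ⟩
          (γ ↑ p) ↑ p ^ e                 ≡⟨ ↑↑ γ p (p ^ e) ⟩
          γ ↑ p ^ suc e                   ≡⟨ exponent-1+e γ ⟩
          𝟏                               ∎)
        where open ≡-Reasoning

      -- `f β` has order `p ^ e` and no p-th root, while `h` has larger order.
      satP-quotient : ∀ {h} → h H.↑ p ^ e ≢ H.𝟏 → ∀ i → suc i ≡ e → SatP p H
      satP-quotient {h} h↑≢ i i≡ = ExponentPrimePower.satP-of-larger-order p pr H K exponentᴴ i
        (trans (cong (λ n → f β H.↑ p ^ n) i≡) fβ↑≡) (fβ↑≢ i i≡) fβ-no-root
        (λ q → h↑≢ (trans (cong (λ n → h H.↑ p ^ n) (sym i≡)) q))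

    satP-either : NonAbelian G → 1 ≤ e → p ≢ 2 ⊎ 2 ≤ e → SatP p G ⊎ SatP p H
    satP-either nonAbelian 1≤e big with roots-or-satP
    ... | inj₂ sat = inj₁ sat
    ... | inj₁ root with all? (λ h → h H.↑ p ^ e H.≟ˣ H.𝟏) H.els
    -- If `p ^ e` kills H, all `p ^ e`-th powers of G lie in the kernel ⟨α⟩, so `α` serves as `z`
    -- and G would be abelian.
    ...   | yes all = ⊥-elim (nonAbelian (Rooted.RankOne.abelian root α α-order
              (λ x → proj₁ (kernel _) (trans (pow-homo x (p ^ e)) (All.lookup all (H.∈els _)))) big))
    ...   | no ¬all with h , h↑≢ ← Any.satisfied (¬All⇒Any¬ (λ h → h H.↑ p ^ e H.≟ˣ H.𝟏) H.els ¬all)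
      with β , β↑ ← Rooted.iterated-root root e ≤-refl (Order.↑d α-order) =
      inj₂ (satP-quotient 1≤e β↑ h↑≢ (pred e) (suc-pred e {{>-nonZero 1≤e}}))

    -- Each factor is a retract of the product, by coordinate embedding and projection.
    satP-product : SatP p G ⊎ SatP p H → SatP p (G ×ᴳ H)
    satP-product = λ where
        (inj₁ sat) → satP-retract pr G (G ×ᴳ H) K exponentˣ (_, H.𝟏) proj₁
          (λ x y → cong (x · y ,_) (sym (H.identityˡ H.𝟏))) (λ _ _ → refl) (λ _ → refl) sat
        (inj₂ sat) → satP-retract pr H (G ×ᴳ H) K exponentˣ (𝟏 ,_) proj₂
          (λ x y → cong (_, x H.· y) (sym (identityˡ 𝟏))) (λ _ _ → refl) (λ _ → refl) sat
      where
      exponentˣ : ∀ x → pow (G ×ᴳ H) x (p ^ K) ≡ ε (G ×ᴳ H)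
      exponentˣ x@(g , h) = cong₂ _,_
        (trans (Hom.pow-homo {G ×ᴳ H} {G} {proj₁} (λ _ _ → refl) x (p ^ K)) (exponent g))
        (trans (Hom.pow-homo {G ×ᴳ H} {H} {proj₂} (λ _ _ → refl) x (p ^ K)) (exponentᴴ h))

-- The quaternion exception and the two parts of the theorem

order-8-quaternion : (pr : Prime 2) (G : FinGroup) (card≡ : card G ≡ 2 ^ 3)
  (exponent-1+e : ∀ x → pow G x 4 ≡ ε G) (full : Carrier G) (full↑≢ : pow G full 2 ≢ ε G)
  (root : ∀ x → pow G x 2 ≡ ε G → ∃[ y ] pow G y 2 ≡ x) (z : Carrier G) (z-order : HasOrder G z 2)
  (socle : ∀ x → InCyclic G z (pow G x 2)) → NonAbelian G → IsoQ8 G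
order-8-quaternion pr G card≡ exponent-1+e full full↑≢ root z z-order socle nonAbelian =
  isoQ8 (proj₂ (proj₂ noncommuting)) card≡
  where
  open Powers G
  open ExactExponent.Rooted 2 pr G 3 card≡ 1 exponent-1+e full full↑≢ root
  open RankOne z z-order socle
  ↑2 : ∀ x → x ↑ 2 ≡ x · x
  ↑2 x = cong (x ·_) (identityʳ x)
  in-socle : ∀ {w} → ⟨ z ⟩ w → w ≡ 𝟏 ⊎ w ≡ z
  in-socle w∈ with Order.bounded-exponent z-order w∈
  ... | 0 , _ , e = inj₁ e
  ... | 1 , _ , e = inj₂ (trans e (↑1 z))
  ... | suc (suc _) , s≤s (s≤s ()) , _
  open Quaternion G z (trans (sym (↑2 z)) (Order.↑d z-order))
    (λ z≡ → proj₂ (proj₂ z-order) 1 ≤-refl ≤-refl (trans (↑1 z) z≡))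
    (cyclicTorsion-central z≤n cyclicTorsion-1)
    (λ x → in-socle (subst ⟨ z ⟩ (↑2 x) (socle x)))
    (λ x e → in-socle (proj₂ cyclicTorsion-1 x (trans (↑2 x) e)))
  noncommuting : ∃[ i ] ∃[ j ] i · j ≢ j · i
  noncommuting with all? (λ x → all? (λ y → x · y ≟ˣ y · x) els) els
  ... | yes all = ⊥-elim (nonAbelian λ x y → All.lookup (All.lookup all (∈els x)) (∈els y))
  ... | no ¬all with i , ¬all′ ← Any.satisfied (¬All⇒Any¬ (λ x → all? (λ y → x · y ≟ˣ y · x) els) els ¬all) =
    i , Any.satisfied (¬All⇒Any¬ (λ y → i · y ≟ˣ y · i) els ¬all′)

-- `suc m` here is the `m` of the theorem. `abelian` excludes everything except `p = 2` with
-- `e < 2`.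
quaternion-of-roots : (p : ℕ) (pr : Prime p) (G : FinGroup) (m n : ℕ) → 1 ≤ n → n ≤ m → card G ≡ p ^ (suc m + n) →
  NonAbelian G → (e : ℕ) → m ≤ e → (∀ x → pow G x (p ^ suc e) ≡ ε G) →
  (full : Carrier G) → pow G full (p ^ e) ≢ ε G → (∀ x → pow G x (p ^ e) ≡ ε G → ∃[ y ] pow G y p ≡ x) →
  (z : Carrier G) → HasOrder G z p → (∀ x → InCyclic G z (pow G x (p ^ e))) → IsoQ8 G
quaternion-of-roots p pr G m n 1≤n n≤m card≡ nonAbelian e m≤e exponent-1+e full full↑≢ root z z-order socle
  with p ℕ.≟ 2 | 2 ≤? e
     | ExactExponent.Rooted.RankOne.abelian p pr G (suc m + n) card≡ e exponent-1+e full full↑≢ root z z-order socle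
... | no p≢2 | _ | abelian = ⊥-elim (nonAbelian (abelian (inj₁ p≢2)))
... | yes _ | yes 2≤e | abelian = ⊥-elim (nonAbelian (abelian (inj₂ 2≤e)))
-- Now `1 ≤ n ≤ m ≤ e ≤ 1`, so all three are 1 and `card G` is 8.
... | yes refl | no 2≰e | _ with refl ← ≤-antisym (≤-trans 1≤n (≤-trans n≤m m≤e)) (≤-pred (≰⇒> 2≰e))
  with refl ← ≤-antisym (≤-trans 1≤n n≤m) m≤e with refl ← ≤-antisym 1≤n n≤m =
  order-8-quaternion pr G card≡ exponent-1+e full full↑≢ root z z-order socle nonAbelian

theorem3p15 : (p : ℕ) → Prime p → (G : FinGroup) → IsPGroup p G → NonAbelian G →
    ((m n : ℕ) → 1 ≤ n → n < m → card G ≡ p ^ (m + n) → ¬ IsoQ8 G →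
    (∃[ g ] HasOrder G g (p ^ m)) → SatP p G)
    × ((∃[ g ] ∃[ k ] (HasOrder G g k × p ^ 2 ≤ k × 8 ≤ k)) →
    (α : Carrier G) → HasOrder G α p → Central G α →
    (H : FinGroup) → IsQuotientByCyclic G α H →
    (SatP p G ⊎ SatP p H) × SatP p (G ×ᴳ H))
theorem3p15 p pr G (K , card≡) nonAbelian = part₁ , part₂
  where
  part₁ : (m n : ℕ) → 1 ≤ n → n < m → card G ≡ p ^ (m + n) → ¬ IsoQ8 G →
    (∃[ g ] HasOrder G g (p ^ m)) → SatP p G
  -- The exponent of `card G` is taken as `suc m + n`, not from `IsPGroup`, so that `small-socle`
  -- can compare it with `suc e + suc e`.
  part₁ (suc m) n 1≤n (s≤s n≤m) card≡′ ¬Q8 (g , g-order)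
    with NonAbelianPGroup.height-exists p pr G (suc m + n) card≡′ nonAbelian
  ... | NonAbelianPGroup.height e exponent-1+e full full↑≢
    with Dichotomy.roots-or-satP p pr G (suc m + n) card≡′ e exponent-1+e full full↑≢
  ... | inj₂ sat = sat
  ... | inj₁ root = ⊥-elim (¬Q8 (quaternion-of-roots p pr G m n 1≤n n≤m card≡′ nonAbelian e m≤e
      exponent-1+e full full↑≢ root z z-order (small-socle (+-mono-≤-< (s≤s m≤e) (s≤s (≤-trans n≤m m≤e))))))
    where
    open Dichotomy p pr G (suc m + n) card≡′ e exponent-1+e full full↑≢
    m≤e : m ≤ e
    m≤e = large-height m g-order

  part₂ : (∃[ g ] ∃[ k ] (HasOrder G g k × p ^ 2 ≤ k × 8 ≤ k)) →
    (α : Carrier G) → HasOrder G α p → Central G α →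
    (H : FinGroup) → IsQuotientByCyclic G α H →
    (SatP p G ⊎ SatP p H) × SatP p (G ×ᴳ H)
  part₂ (g , k , g-order , p²≤k , 8≤k) α α-order α-central H (f , hom , surjective , kernel)
    with NonAbelianPGroup.height-exists p pr G K card≡ nonAbelian
  ... | NonAbelianPGroup.height e exponent-1+e full full↑≢ = either , satP-product either
    where
    open PGroup p pr G K card≡
    open Dichotomy p pr G K card≡ e exponent-1+e full full↑≢
    open Quotient {H} α-order α-central f hom surjective kernel
    either : SatP p G ⊎ SatP p H
    either with divisor-of-power K (Order.order-∣ g-order (exponent g))
    -- Here `k` would be 1.
    ... | zero , _ , refl = ⊥-elim (<⇒≱ (s≤s (s≤s z≤n)) 8≤k)
    ... | suc i , _ , refl = satP-either nonAbelian
      (≤-trans (≤-pred (^-cancel-≤ {2} {suc i} p²≤k)) i≤e) big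
      where
      i≤e : i ≤ e
      i≤e = large-height i g-order
      big : p ≢ 2 ⊎ 2 ≤ e
      big with p ℕ.≟ 2
      ... | no p≢2 = inj₁ p≢2
      -- For `p = 2` the bound 8 is `p ^ 3`, which gives `2 ≤ i`.
      ... | yes p≡2 = inj₂ (≤-trans (≤-pred (^-cancel-≤ {3} {suc i} (subst (λ q → q ^ 3 ≤ p ^ suc i) (sym p≡2) 8≤k))) i≤e)
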